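{- For all integers $n\geq 0$, $c_{3}(11n+5)\equiv 0 \pmod 2$, $c_{3}(11n+7)\equiv 0 \pmod 2$, and $c_{3}(11n+9)\equiv 0 \pmod 2$.
   Context: A partition of $n$ is a finite non-increasing sequence of positive integers (its parts) summing to $n$; the multiplicity of a part is the number of times it occurs. Let $c_{3}(n)$ be the number of partitions of $n$ for which there is a positive integer $j$ such that: the part $1$ appears with multiplicity exactly $j^{2}$ or $j^{2}+1$; odd parts greater than $1$ are distinct; all even parts are distinct; even parts greater than $2j$ are at least $4j+4$ and divisible by $4$; and no even integer in the set $\{2j+2,2j+4,\ldots,4j+2\}$ appears as a part. -}

module Defs where

open import Data.Nat using (ℕ; zero; suc; _+_; _*_; _≤_; _<_)
open import Data.Nat.Divisibility using (_∣_)
open import Data.Nat.ListAction using (sum)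
open import Data.List using (List; []; _∷_; length)
open import Data.List.Relation.Unary.All using (All)
open import Data.List.Relation.Unary.Linked using (Linked)
open import Data.List.Relation.Unary.Unique.Propositional using (Unique)
open import Data.List.Membership.Propositional using (_∈_; _∉_)
open import Data.Product using (Σ; ∃; _×_)
open import Data.Sum using (_⊎_)
open import Relation.Binary.PropositionalEquality using (_≡_)
open import Relation.Nullary using (¬_; yes; no)
open import Function.Bundles using (_⇔_)
open import Data.Nat using (_≟_; _≥_)

record IsPartition (n : ℕ) (p : List ℕ) : Set where
  field
    positive    : All (λ k → 1 ≤ k) p
    nonIncr     : Linked _≥_ p
    sumEq       : sum p ≡ n

mult : ℕ → List ℕ → ℕ
mult k [] = 0
mult k (x ∷ p) with x ≟ k
... | yes _ = suc (mult k p)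
... | no  _ = mult k p

Odd Even : ℕ → Set
Even k = 2 ∣ k
Odd k = ¬ (2 ∣ k)

record C3Cond (j : ℕ) (p : List ℕ) : Set where
  field
    jPos        : 1 ≤ j
    ones        : (mult 1 p ≡ j * j) ⊎ (mult 1 p ≡ j * j + 1)
    oddDistinct : ∀ k → Odd k → 1 < k → mult k p ≤ 1
    evenDistinct : ∀ k → Even k → mult k p ≤ 1
    largeEven   : ∀ k → k ∈ p → Even k → 2 * j < k → (4 * j + 4 ≤ k) × (4 ∣ k)
    gap         : ∀ i → j + 1 ≤ i → i ≤ 2 * j + 1 → 2 * i ∉ p

C3Partition : ℕ → List ℕ → Set
C3Partition n p = IsPartition n p × ∃ λ j → C3Cond j p

HasCount : (List ℕ → Set) → ℕ → Set
HasCount P c = Σ (List (List ℕ)) λ L → Unique L × (∀ p → (p ∈ L) ⇔ P p) × (length L ≡ c)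

C3Even : ℕ → Set
C3Even n = ∃ λ c → HasCount (C3Partition n) c × (2 ∣ c)

{-# OPTIONS --safe #-}
module Submission where

-- Modulo 2, (1 + q^2m)² = 1 + q^4m, so with O = ∏ (1 + q^(2m-1)) and E = ∏ (1 + q^2m) the
-- generating function of c₃ is O E Σ_{j≥1} q^(j²) ∏_{m>j} (1 + q^2m).  By Euler's identity the
-- sum started at j = 0 equals O E, so the generating function is (O E)² + O E².
-- Both terms are Jacobi triple products ∏ (1 + q^Mm)(1 + q^(Mm-a))(1 + q^(Mm-b)), M = a + b, with
-- (a, b) = (4, 2) and (3, 1); hence the exponents that occur are 3k² ± k and 2k² ± k, and these
-- miss the residues 5, 7 and 9 modulo 11.
-- Euler's identity and the triple product follow from one telescoping argument: multiplying
-- Σ_j q^(y j) ∏_{m>j} (1 + q^Mm) by a suitable 1 + q^c only changes the exponents y.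

open import Defs
open import Data.Nat using (ℕ; zero; suc; _+_; _*_; _∸_; _≤_; _<_; _>_; _≥_; z≤n; s≤s;
  _%_; _/_; _≤?_; _≟_; parity)
open import Data.Nat.Properties hiding (_≤?_; _≟_)
open import Data.Nat.DivMod using ([m+kn]%n≡m%n; m≡m%n+[m/n]*n; m%n<n; m<n⇒m%n≡m)
open import Data.Nat.Divisibility using (_∣_; _∣?_; divides; n∣m*n; m∣m*n; ∣m∣n⇒∣m+n; ∣m+n∣m⇒∣n; ∣⇒≤)
open import Data.Nat.ListAction using (sum)
open import Data.Nat.ListAction.Properties using (sum-++)
open import Data.Nat.Tactic.RingSolver using (solve-∀)
open import Data.Parity.Base using (Parity; 0ℙ; 1ℙ) renaming (_+_ to _+ₚ_)
import Data.Parity.Properties as ℙ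
import Algebra.Properties.CommutativeSemigroup ℙ.+-commutativeSemigroup as ℙ⁺
open import Data.Bool using (if_then_else_)
open import Data.List using (List; []; _∷_; _++_; length; map; replicate)
open import Data.List.Properties using (length-++; length-map; ∷-injectiveʳ; ++-cancelʳ)
open import Data.List.Membership.Propositional using (_∈_)
open import Data.List.Membership.Propositional.Properties
  using (∈-++⁺ˡ; ∈-++⁺ʳ; ∈-++⁻; ∈-map⁺; ∈-map⁻)
open import Data.List.Relation.Unary.All as All using (All; []; _∷_)
import Data.List.Relation.Unary.All.Properties as All
open import Data.List.Relation.Unary.Any using (here)
open import Data.List.Relation.Unary.AllPairs as AllPairs using (AllPairs; []; _∷_)
import Data.List.Relation.Unary.AllPairs.Properties as AllPairs
import Data.List.Relation.Unary.Linked.Properties as Linked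
open import Data.List.Relation.Unary.Unique.Propositional using (Unique)
import Data.List.Relation.Unary.Unique.Propositional.Properties as Unique
open import Data.Product using (_×_; _,_; proj₁; proj₂; ∃)
open import Data.Sum using (_⊎_; inj₁; inj₂)
open import Data.Empty using (⊥)
open import Function using (_∘_)
open import Function.Bundles using (mk⇔)
open import Level using (0ℓ)
open import Relation.Binary.Bundles using (Setoid)
import Relation.Binary.Reasoning.Setoid as SetoidReasoning
open import Relation.Binary.PropositionalEquality
  using (_≡_; _≢_; refl; sym; trans; cong; cong₂; subst; module ≡-Reasoning)
open import Relation.Nullary using (¬_; Dec; yes; no; does; contradiction)
open import Relation.Nullary.Decidable using (¬?; _⊎-dec_; _×-dec_; dec-true; dec-false; from-yes)

-- Two devices keep the infinite products elementary. Every identity is a congruence modulo X^N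
-- between finite products with enough factors, and N is fixed only when a coefficient is read off.
-- And Euler's series Σ q^(ak + Mk(k-1)/2) / ((1 - q^M)...(1 - q^(Mk))) is used only after
-- multiplication by ∏ (1 - q^(Mm)): this clears the denominators, and modulo 2 it leaves exactly
-- the products over m > k that occur in the sum for c₃. So no series is inverted, and one kind of
-- sum serves both identities: extracting factors 1 + q^(a + Mi) raises the linear coefficient of
-- the exponent until only k = 0 survives, while multiplying by factors 1 + q^(b + Mi) moves the
-- first index from 0 down to -N, where the products over m > k no longer matter below q^N. The
-- residues come from completing the square. If 3k² ± k ≡ r modulo 11, then 12r + 1 is the square of
-- 6k ± 1; if 2k² ± k ≡ r, then 8r + 1 is the square of 4k ± 1. Both 12r + 1 and 8r + 1 are
-- nonresidues modulo 11 exactly for r = 5, 7, 9.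

-- Power series over the field with two elements

-- Generic because it has two uses: on parities it multiplies a series by X^m, on lists of
-- partitions it moves the weight by m. `shift-parity` compares the two.
shift : {A : Set} → A → ℕ → (ℕ → A) → ℕ → A
shift z zero    f n       = f n
shift z (suc m) f zero    = z
shift z (suc m) f (suc n) = shift z m f n

Series : Set
Series = ℕ → Parity

infixr 8 X^_·_ 1+X^_·_ _⊙_
infixl 6 _⊕_
infix  4 _≈[_]_

0s 1s : Series
0s _ = 0ℙ
1s zero    = 1ℙ
1s (suc _) = 0ℙ

opaque
  _⊕_ : Series → Series → Series
  (f ⊕ g) n = f n +ₚ g n

  X^_·_ : ℕ → Series → Series
  X^ m · f = shift 0ℙ m f

1+X^_·_ : ℕ → Series → Series
1+X^ m · f = f ⊕ X^ m · f

-- A list of exponents stands for the product of its factors 1 + X^m. Series are multiplied only by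
-- monomials and by such binomials, so convolution never enters.
_⊙_ : List ℕ → Series → Series
[]       ⊙ f = f
(m ∷ ms) ⊙ f = 1+X^ m · ms ⊙ f

∑ : ℕ → (ℕ → Series) → Series
∑ zero    t = 0s
∑ (suc J) t = ∑ J t ⊕ t J

-- Congruence modulo X^N. As a record, unlike a bare function type, it lets `f` and `g` be inferred
-- from the type of a proof.
record _≈[_]_ (f : Series) (N : ℕ) (g : Series) : Set where
  constructor below
  field coeff : ∀ n → n < N → f n ≡ g n
open _≈[_]_ public

weaken : ∀ {M N f g} → N ≤ M → f ≈[ M ] g → f ≈[ N ] g
weaken N≤M (below e) = below λ n n<N → e n (≤-trans n<N N≤M)

opaque
  unfolding _⊕_ X^_·_

  ⊕-coeff : ∀ f g n → (f ⊕ g) n ≡ f n +ₚ g n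
  ⊕-coeff f g n = refl

  X-coeff : ∀ m f n → (X^ m · f) n ≡ shift 0ℙ m f n
  X-coeff m f n = refl

  X^0 : ∀ f n → (X^ 0 · f) n ≡ f n
  X^0 f n = refl

  X-raise : ∀ {N f g} m → f ≈[ N ] g → X^ m · f ≈[ m + N ] X^ m · g
  X-raise zero    f≈g = f≈g
  X-raise (suc m) f≈g = below λ
    { zero    _         → refl
    ; (suc n) (s≤s n<N) → coeff (X-raise m f≈g) n n<N }

  X-X : ∀ m k f n → (X^ m · X^ k · f) n ≡ (X^ (m + k) · f) n
  X-X zero    k f n       = refl
  X-X (suc m) k f zero    = refl
  X-X (suc m) k f (suc n) = X-X m k f n

  X-⊕ : ∀ m f g n → (X^ m · (f ⊕ g)) n ≡ (X^ m · f ⊕ X^ m · g) n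
  X-⊕ zero    f g n       = refl
  X-⊕ (suc m) f g zero    = refl
  X-⊕ (suc m) f g (suc n) = X-⊕ m f g n

  X-0 : ∀ m n → (X^ m · 0s) n ≡ 0ℙ
  X-0 zero    n       = refl
  X-0 (suc m) zero    = refl
  X-0 (suc m) (suc n) = X-0 m n

  X-low : ∀ m f n → n < m → (X^ m · f) n ≡ 0ℙ
  X-low (suc m) f zero    _         = refl
  X-low (suc m) f (suc n) (s≤s n<m) = X-low m f n n<m

  X-1 : ∀ m n → m ≢ n → (X^ m · 1s) n ≡ 0ℙ
  X-1 zero    zero    m≢n = contradiction refl m≢n
  X-1 zero    (suc n) m≢n = refl
  X-1 (suc m) zero    m≢n = refl
  X-1 (suc m) (suc n) m≢n = X-1 m n λ e → m≢n (cong suc e)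

+ₚ-cancel : ∀ a b c → (a +ₚ b) +ₚ (c +ₚ b) ≡ a +ₚ c
+ₚ-cancel a b c = trans (ℙ⁺.interchange a b c b)
  (trans (cong ((a +ₚ c) +ₚ_) (ℙ.p+p≡0ℙ b)) (ℙ.+-identityʳ (a +ₚ c)))

-- Progressions and quadratic exponents

progression : ℕ → ℕ → ℕ → List ℕ
progression a d zero    = []
progression a d (suc K) = a + d * K ∷ progression a d K

-- quad M a k = a k + M k(k-1)/2.
quad : ℕ → ℕ → ℕ → ℕ
quad M a zero    = 0
quad M a (suc k) = quad M a k + (a + M * k)

k≤quad : ∀ M {a} k → 1 ≤ a → k ≤ quad M a k
k≤quad M     zero    1≤a = z≤n
k≤quad M {a} (suc k) 1≤a = begin
  suc k                  ≡⟨ +-comm 1 k ⟩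
  k + 1                  ≤⟨ +-mono-≤ (k≤quad M k 1≤a) (≤-trans 1≤a (m≤m+n a (M * k))) ⟩
  quad M a k + (a + M * k) ∎
  where open ≤-Reasoning

-- Together with `quad-shift′` this describes the effect of the factor 1 + X^a on the exponents
-- `quad M (a + M)`: with y = `quad M a`, the two results are y k + M k and y (k + 1), the pair that
-- `telescope` consumes.
quad-shift : ∀ M a k → quad M (a + M) k ≡ quad M a k + M * k
quad-shift M a zero    = sym (*-zeroʳ M)
quad-shift M a (suc k) = trans (cong (_+ (a + M + M * k)) (quad-shift M a k))
                               (eq (quad M a k) M a k)
  where
  eq : ∀ q M a k → q + M * k + (a + M + M * k) ≡ q + (a + M * k) + M * suc k
  eq = solve-∀

quad-shift′ : ∀ M a k → a + quad M (a + M) k ≡ quad M a (suc k)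
quad-shift′ M a k = trans (cong (a +_) (quad-shift M a k)) (eq (quad M a k) M a k)
  where
  eq : ∀ q M a k → a + (q + M * k) ≡ q + (a + M * k)
  eq = solve-∀

-- The exponent a k(k+1)/2 + b k(k-1)/2 at k = j - P.
bilateral : ℕ → ℕ → ℕ → ℕ → ℕ
bilateral a b zero    j       = quad (a + b) a j
bilateral a b (suc P) zero    = quad (a + b) b (suc P)
bilateral a b (suc P) (suc j) = bilateral a b P j

-- The counterpart of `quad-shift` for the factor 1 + X^(b + (a + b)P). The other exponent of the
-- pair, `bilateral a b (suc P) (suc j)`, is `bilateral a b P j` by definition: raising P only moves
-- the first index from -P to -P - 1.
bilateral-shift : ∀ a b P j →
  b + (a + b) * P + bilateral a b P j ≡ bilateral a b (suc P) j + (a + b) * j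
bilateral-shift a b zero zero = eq a b
  where
  eq : ∀ a b → b + (a + b) * 0 + 0 ≡ 0 + (b + (a + b) * 0) + (a + b) * 0
  eq = solve-∀
bilateral-shift a b zero (suc j) = eq (quad (a + b) a j) a b j
  where
  eq : ∀ q a b j → b + (a + b) * 0 + (q + (a + (a + b) * j)) ≡ q + (a + b) * suc j
  eq = solve-∀
bilateral-shift a b (suc P) zero = eq (quad (a + b) b (suc P)) a b P
  where
  eq : ∀ q a b P → b + (a + b) * suc P + q ≡ q + (b + (a + b) * suc P) + (a + b) * 0
  eq = solve-∀
bilateral-shift a b (suc P) (suc j) =
  trans (eqˡ (bilateral a b P j) a b P)
  (trans (cong (_+ (a + b)) (bilateral-shift a b P j))
         (eqʳ (bilateral a b (suc P) j) a b j))
  where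
  eqˡ : ∀ q a b P → b + (a + b) * suc P + q ≡ b + (a + b) * P + q + (a + b)
  eqˡ = solve-∀
  eqʳ : ∀ q a b j → q + (a + b) * j + (a + b) ≡ q + (a + b) * suc j
  eqʳ = solve-∀

-- Makes the boundary term vanish in `jacobi-step`: after a shift by P ≤ N, an index K ≥ 2N still
-- has an exponent of at least N.
j≤P+bilateral : ∀ {a} b P j → 1 ≤ a → j ≤ P + bilateral a b P j
j≤P+bilateral {a} b zero    j       1≤a = k≤quad (a + b) j 1≤a
j≤P+bilateral     b (suc P) zero    1≤a = z≤n
j≤P+bilateral     b (suc P) (suc j) 1≤a = s≤s (j≤P+bilateral b P j 1≤a)

-- Used with P = N: replacing the tail at j by 1 causes an error only from this power of X on. For
-- small j the exponent is large; for j near P it is small, but (a + b)(j + 1) is large.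
P<bilateral : ∀ {a b} P j → 1 ≤ a → 1 ≤ b → P < bilateral a b P j + (a + b) * suc j
P<bilateral {a} {b} zero j 1≤a 1≤b =
  ≤-trans (≤-trans 1≤a (m≤m+n a b))
  (≤-trans (m≤m*n (a + b) (suc j)) (m≤n+m _ (quad (a + b) a j)))
P<bilateral {a} {b} (suc P) zero 1≤a 1≤b = begin
  suc (suc P)                                      ≡⟨ +-comm 1 (suc P) ⟩
  suc P + 1                                        ≤⟨ +-mono-≤ (k≤quad (a + b) (suc P) 1≤b) (≤-trans 1≤a (m≤m+n a b)) ⟩
  quad (a + b) b (suc P) + (a + b)                 ≡⟨ cong (quad (a + b) b (suc P) +_) (sym (*-identityʳ (a + b))) ⟩
  quad (a + b) b (suc P) + (a + b) * 1             ∎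
  where open ≤-Reasoning
P<bilateral {a} {b} (suc P) (suc j) 1≤a 1≤b = begin
  suc (suc P)                                         ≡⟨ +-comm 1 (suc P) ⟩
  suc P + 1                                           ≤⟨ +-mono-≤ (P<bilateral P j 1≤a 1≤b) (≤-trans 1≤a (m≤m+n a b)) ⟩
  bilateral a b P j + (a + b) * suc j + (a + b)       ≡⟨ eq (bilateral a b P j) a b j ⟩
  bilateral a b P j + (a + b) * suc (suc j)           ∎
  where
  open ≤-Reasoning
  eq : ∀ q a b j → q + (a + b) * suc j + (a + b) ≡ q + (a + b) * suc (suc j)
  eq = solve-∀

bilateral-avoids : ∀ {n} a b P j → (∀ k → quad (a + b) a k ≢ n) → (∀ k → quad (a + b) b k ≢ n) →
  bilateral a b P j ≢ n
bilateral-avoids a b zero    j       p q = p j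
bilateral-avoids a b (suc P) zero    p q = q (suc P)
bilateral-avoids a b (suc P) (suc j) p q = bilateral-avoids a b P j p q

-- Calculus of products modulo X^N

module Truncated (N : ℕ) where

  infix 4 _≈_
  _≈_ : Series → Series → Set
  f ≈ g = f ≈[ N ] g

  ≈-setoid : Setoid 0ℓ 0ℓ
  ≈-setoid = record
    { Carrier = Series
    ; _≈_ = _≈_
    ; isEquivalence = record
      { refl  = below λ _ _ → refl
      ; sym   = λ (below e) → below λ n n<N → sym (e n n<N)
      ; trans = λ (below e) (below e′) → below λ n n<N → trans (e n n<N) (e′ n n<N)
      }
    }
  open Setoid ≈-setoid using () renaming (refl to ≈-refl; sym to ≈-sym; trans to ≈-trans) public
  open SetoidReasoning ≈-setoid

  N≤MN : ∀ {M} → 1 ≤ M → N ≤ M * N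
  N≤MN 1≤M = ≤-trans (≤-reflexive (sym (*-identityˡ N))) (*-monoˡ-≤ N 1≤M)

  exact : ∀ {f g} → (∀ n → f n ≡ g n) → f ≈ g
  exact e = below λ n _ → e n

  opaque
    unfolding _⊕_

    ⊕-cong : ∀ {f f′ g g′} → f ≈ f′ → g ≈ g′ → f ⊕ g ≈ f′ ⊕ g′
    ⊕-cong (below e) (below e′) = below λ n n<N → cong₂ _+ₚ_ (e n n<N) (e′ n n<N)

    ⊕-comm : ∀ f g → f ⊕ g ≈ g ⊕ f
    ⊕-comm f g = exact λ n → ℙ.+-comm (f n) (g n)

    ⊕-assoc : ∀ f g h → (f ⊕ g) ⊕ h ≈ f ⊕ (g ⊕ h)
    ⊕-assoc f g h = exact λ n → ℙ.+-assoc (f n) (g n) (h n)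

    ⊕-identityʳ : ∀ f → f ⊕ 0s ≈ f
    ⊕-identityʳ f = exact λ n → ℙ.+-identityʳ (f n)

    ⊕-interchange : ∀ f g h k → (f ⊕ g) ⊕ (h ⊕ k) ≈ (f ⊕ h) ⊕ (g ⊕ k)
    ⊕-interchange f g h k = exact λ n → ℙ⁺.interchange (f n) (g n) (h n) (k n)

    ⊕-cancel : ∀ f g h → (f ⊕ g) ⊕ (h ⊕ g) ≈ f ⊕ h
    ⊕-cancel f g h = exact λ n → +ₚ-cancel (f n) (g n) (h n)

  X-cong : ∀ {f g} m → f ≈ g → X^ m · f ≈ X^ m · g
  X-cong m f≈g = weaken (m≤n+m N m) (X-raise m f≈g)

  X-≡ : ∀ {m k} f → m ≡ k → X^ m · f ≈ X^ k · f
  X-≡ f refl = ≈-refl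

  X-vanish : ∀ {m} f → N ≤ m → X^ m · f ≈ 0s
  X-vanish {m} f N≤m = below λ n n<N → X-low m f n (≤-trans n<N N≤m)

  1+X-cong : ∀ {f g} m → f ≈ g → 1+X^ m · f ≈ 1+X^ m · g
  1+X-cong m f≈g = ⊕-cong f≈g (X-cong m f≈g)

  1+X-≡ : ∀ {m k} f → m ≡ k → 1+X^ m · f ≈ 1+X^ k · f
  1+X-≡ f refl = ≈-refl

  1+X-high : ∀ {m} f → N ≤ m → 1+X^ m · f ≈ f
  1+X-high f N≤m = ≈-trans (⊕-cong ≈-refl (X-vanish f N≤m)) (⊕-identityʳ f)

  1+X-X : ∀ m k f → 1+X^ m · X^ k · f ≈ X^ k · f ⊕ X^ (m + k) · f
  1+X-X m k f = ⊕-cong ≈-refl (exact (X-X m k f))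

  X-1+X : ∀ m k f → X^ m · 1+X^ k · f ≈ X^ m · f ⊕ X^ (m + k) · f
  X-1+X m k f = ≈-trans (exact (X-⊕ m f (X^ k · f))) (⊕-cong ≈-refl (exact (X-X m k f)))

  X-1+X-comm : ∀ m k f → X^ m · 1+X^ k · f ≈ 1+X^ k · X^ m · f
  X-1+X-comm m k f = ≈-trans (X-1+X m k f)
    (≈-trans (⊕-cong ≈-refl (X-≡ f (+-comm m k))) (≈-sym (1+X-X k m f)))

  1+X-⊕ : ∀ m f g → 1+X^ m · (f ⊕ g) ≈ 1+X^ m · f ⊕ 1+X^ m · g
  1+X-⊕ m f g = ≈-trans (⊕-cong ≈-refl (exact (X-⊕ m f g))) (⊕-interchange f g _ _)

  1+X-comm : ∀ m k f → 1+X^ m · 1+X^ k · f ≈ 1+X^ k · 1+X^ m · f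
  1+X-comm m k f = begin
    1+X^ k · f ⊕ X^ m · 1+X^ k · f       ≈⟨ ⊕-cong ≈-refl (X-1+X-comm m k f) ⟩
    1+X^ k · f ⊕ 1+X^ k · X^ m · f       ≈⟨ 1+X-⊕ k f (X^ m · f) ⟨
    1+X^ k · 1+X^ m · f                  ∎

  1+X-square : ∀ m f → 1+X^ m · 1+X^ m · f ≈ 1+X^ (m + m) · f
  1+X-square m f = begin
    1+X^ m · f ⊕ X^ m · 1+X^ m · f             ≈⟨ ⊕-cong ≈-refl (≈-trans (X-1+X m m f) (⊕-comm _ _)) ⟩
    (f ⊕ X^ m · f) ⊕ (X^ (m + m) · f ⊕ X^ m · f) ≈⟨ ⊕-cancel f _ _ ⟩
    f ⊕ X^ (m + m) · f                         ∎

  ⊙-cong : ∀ {f g} ms → f ≈ g → ms ⊙ f ≈ ms ⊙ g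
  ⊙-cong []       f≈g = f≈g
  ⊙-cong (m ∷ ms) f≈g = 1+X-cong m (⊙-cong ms f≈g)

  ⊙-1+X : ∀ ms m f → ms ⊙ 1+X^ m · f ≈ 1+X^ m · ms ⊙ f
  ⊙-1+X []       m f = ≈-refl
  ⊙-1+X (k ∷ ms) m f = ≈-trans (1+X-cong k (⊙-1+X ms m f)) (1+X-comm k m (ms ⊙ f))

  ⊙-comm : ∀ ms ks f → ms ⊙ ks ⊙ f ≈ ks ⊙ ms ⊙ f
  ⊙-comm ms []       f = ≈-refl
  ⊙-comm ms (k ∷ ks) f = ≈-trans (⊙-1+X ms k (ks ⊙ f)) (1+X-cong k (⊙-comm ms ks f))

  ⊙-X : ∀ ms m f → ms ⊙ X^ m · f ≈ X^ m · ms ⊙ f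
  ⊙-X []       m f = ≈-refl
  ⊙-X (k ∷ ms) m f = ≈-trans (1+X-cong k (⊙-X ms m f)) (≈-sym (X-1+X-comm m k (ms ⊙ f)))

  ⊙-⊕ : ∀ ms f g → ms ⊙ (f ⊕ g) ≈ ms ⊙ f ⊕ ms ⊙ g
  ⊙-⊕ []       f g = ≈-refl
  ⊙-⊕ (m ∷ ms) f g = ≈-trans (1+X-cong m (⊙-⊕ ms f g)) (1+X-⊕ m (ms ⊙ f) (ms ⊙ g))

  ⊙-0 : ∀ ms → ms ⊙ 0s ≈ 0s
  ⊙-0 []       = ≈-refl
  ⊙-0 (m ∷ ms) = ≈-trans (1+X-cong m (⊙-0 ms))
    (≈-trans (⊕-cong ≈-refl (exact (X-0 m))) (⊕-identityʳ 0s))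

  ∑-cong : ∀ {t u} J → (∀ j → j < J → t j ≈ u j) → ∑ J t ≈ ∑ J u
  ∑-cong zero    t≈u = ≈-refl
  ∑-cong (suc J) t≈u = ⊕-cong (∑-cong J λ j j<J → t≈u j (m<n⇒m<1+n j<J)) (t≈u J ≤-refl)

  ∑-⊙ : ∀ ms J t → ms ⊙ ∑ J t ≈ ∑ J λ j → ms ⊙ t j
  ∑-⊙ ms zero    t = ⊙-0 ms
  ∑-⊙ ms (suc J) t = ≈-trans (⊙-⊕ ms (∑ J t) (t J)) (⊕-cong (∑-⊙ ms J t) ≈-refl)

  ∑-split-first : ∀ J t → ∑ (suc J) t ≈ t 0 ⊕ ∑ J λ j → t (suc j)
  ∑-split-first zero    t = ⊕-comm 0s (t 0)
  ∑-split-first (suc J) t =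
    ≈-trans (⊕-cong (∑-split-first J t) ≈-refl) (⊕-assoc (t 0) _ (t (suc J)))

  ∑-0 : ∀ {t} J → (∀ j → t j ≈ 0s) → ∑ J t ≈ 0s
  ∑-0 zero    t≈0 = ≈-refl
  ∑-0 (suc J) t≈0 = ≈-trans (⊕-cong (∑-0 J t≈0) (t≈0 J)) (⊕-identityʳ 0s)

  -- `progression` grows at its large end, but `tail-step` has to remove the smallest factor.
  progression-first : ∀ a d K f →
    progression a d (suc K) ⊙ f ≈ 1+X^ a · progression (a + d) d K ⊙ f
  progression-first a d zero    f = 1+X-≡ f (trans (cong (a +_) (*-zeroʳ d)) (+-identityʳ a))
  progression-first a d (suc K) f = begin
    1+X^ (a + d * suc K) · progression a d (suc K) ⊙ f
      ≈⟨ 1+X-cong (a + d * suc K) (progression-first a d K f) ⟩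
    1+X^ (a + d * suc K) · 1+X^ a · progression (a + d) d K ⊙ f
      ≈⟨ 1+X-≡ _ (eq a d K) ⟩
    1+X^ (a + d + d * K) · 1+X^ a · progression (a + d) d K ⊙ f
      ≈⟨ 1+X-comm (a + d + d * K) a _ ⟩
    1+X^ a · progression (a + d) d (suc K) ⊙ f ∎
    where
    eq : ∀ a d K → a + d * suc K ≡ a + d + d * K
    eq = solve-∀

  progression-++ : ∀ a d J K f →
    progression a d (K + J) ⊙ f ≈ progression (a + d * J) d K ⊙ progression a d J ⊙ f
  progression-++ a d J zero    f = ≈-refl
  progression-++ a d J (suc K) f = ≈-trans (1+X-≡ _ (eq a d J K))
    (1+X-cong (a + d * J + d * K) (progression-++ a d J K f))
    where
    eq : ∀ a d J K → a + d * (K + J) ≡ a + d * J + d * K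
    eq = solve-∀

  progression-high : ∀ {a} d K f → N ≤ a → progression a d K ⊙ f ≈ f
  progression-high     d zero    f N≤a = ≈-refl
  progression-high {a} d (suc K) f N≤a =
    ≈-trans (1+X-high _ (≤-trans N≤a (m≤m+n a (d * K)))) (progression-high d K f N≤a)

  -- Factors of index N and beyond have exponents of at least N. Products of 2N, 3N or L ≥ N factors
  -- may therefore all be cut down to N.
  progression-stable : ∀ a {d K} f → 1 ≤ d → N ≤ K → progression a d K ⊙ f ≈ progression a d N ⊙ f
  progression-stable a {d} {K} f 1≤d N≤K = begin
    progression a d K ⊙ f
      ≡⟨ cong (λ k → progression a d k ⊙ f) (sym (m∸n+n≡m N≤K)) ⟩
    progression a d (K ∸ N + N) ⊙ f
      ≈⟨ progression-++ a d N (K ∸ N) f ⟩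
    progression (a + d * N) d (K ∸ N) ⊙ progression a d N ⊙ f
      ≈⟨ progression-high d (K ∸ N) _ (≤-trans (N≤MN 1≤d) (m≤n+m (d * N) a)) ⟩
    progression a d N ⊙ f ∎

  -- Squaring is the Frobenius map, applied factor by factor.
  progression-square : ∀ a d K f →
    progression a d K ⊙ progression a d K ⊙ f ≈ progression (a + a) (d + d) K ⊙ f
  progression-square a d zero    f = ≈-refl
  progression-square a d (suc K) f = begin
    1+X^ m · ms ⊙ 1+X^ m · ms ⊙ f      ≈⟨ 1+X-cong m (⊙-1+X ms m (ms ⊙ f)) ⟩
    1+X^ m · 1+X^ m · ms ⊙ ms ⊙ f      ≈⟨ 1+X-square m _ ⟩
    1+X^ (m + m) · ms ⊙ ms ⊙ f         ≈⟨ 1+X-cong (m + m) (progression-square a d K f) ⟩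
    1+X^ (m + m) · ms² ⊙ f             ≈⟨ 1+X-≡ (ms² ⊙ f) (eq a d K) ⟩
    1+X^ (a + a + (d + d) * K) · ms² ⊙ f ∎
    where
    m = a + d * K
    ms = progression a d K
    ms² = progression (a + a) (d + d) K
    eq : ∀ a d K → a + d * K + (a + d * K) ≡ a + a + (d + d) * K
    eq = solve-∀

  progression-halves : ∀ a d K f → progression a d (K * 2) ⊙ f ≈
    progression a (d * 2) K ⊙ progression (a + d) (d * 2) K ⊙ f
  progression-halves a d zero    f = ≈-refl
  progression-halves a d (suc K) f = begin
    1+X^ (a + d * suc (K * 2)) · 1+X^ (a + d * (K * 2)) · progression a d (K * 2) ⊙ f
      ≈⟨ 1+X-cong _ (1+X-cong (a + d * (K * 2)) (progression-halves a d K f)) ⟩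
    1+X^ (a + d * suc (K * 2)) · 1+X^ (a + d * (K * 2)) · ps ⊙ qs ⊙ f
      ≈⟨ 1+X-≡ _ (eq₁ a d K) ⟩
    1+X^ (a + d + d * 2 * K) · 1+X^ (a + d * (K * 2)) · ps ⊙ qs ⊙ f
      ≈⟨ 1+X-cong _ (1+X-≡ _ (eq₀ a d K)) ⟩
    1+X^ (a + d + d * 2 * K) · 1+X^ (a + d * 2 * K) · ps ⊙ qs ⊙ f
      ≈⟨ ⊙-1+X (progression a (d * 2) (suc K)) (a + d + d * 2 * K) (qs ⊙ f) ⟨
    1+X^ (a + d * 2 * K) · ps ⊙ 1+X^ (a + d + d * 2 * K) · qs ⊙ f ∎
    where
    ps = progression a (d * 2) K
    qs = progression (a + d) (d * 2) K
    eq₀ : ∀ a d K → a + d * (K * 2) ≡ a + d * 2 * K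
    eq₀ = solve-∀
    eq₁ : ∀ a d K → a + d * suc (K * 2) ≡ a + d + d * 2 * K
    eq₁ = solve-∀

  progression-thirds : ∀ a d K f → progression a d (K * 3) ⊙ f ≈
    progression a (d * 3) K ⊙ progression (a + d) (d * 3) K ⊙ progression (a + d + d) (d * 3) K ⊙ f
  progression-thirds a d zero    f = ≈-refl
  progression-thirds a d (suc K) f = begin
    1+X^ (a + d * suc (suc (K * 3))) · 1+X^ (a + d * suc (K * 3)) · 1+X^ (a + d * (K * 3)) ·
      progression a d (K * 3) ⊙ f
      ≈⟨ 1+X-cong _ (1+X-cong _ (1+X-cong (a + d * (K * 3)) (progression-thirds a d K f))) ⟩
    1+X^ (a + d * suc (suc (K * 3))) · 1+X^ (a + d * suc (K * 3)) · 1+X^ (a + d * (K * 3)) ·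
      ps ⊙ qs ⊙ rs ⊙ f
      ≈⟨ ≈-trans (1+X-≡ _ (eq₂ a d K)) (1+X-cong r (≈-trans (1+X-≡ _ (eq₁ a d K))
           (1+X-cong q (1+X-≡ _ (eq₀ a d K))))) ⟩
    1+X^ r · 1+X^ q · 1+X^ p · ps ⊙ qs ⊙ rs ⊙ f
      ≈⟨ 1+X-cong r (⊙-1+X (p ∷ ps) q (qs ⊙ rs ⊙ f)) ⟨
    1+X^ r · (p ∷ ps) ⊙ (q ∷ qs) ⊙ rs ⊙ f
      ≈⟨ ⊙-1+X (p ∷ ps) r ((q ∷ qs) ⊙ rs ⊙ f) ⟨
    (p ∷ ps) ⊙ 1+X^ r · (q ∷ qs) ⊙ rs ⊙ f
      ≈⟨ ⊙-cong (p ∷ ps) (⊙-1+X (q ∷ qs) r (rs ⊙ f)) ⟨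
    (p ∷ ps) ⊙ (q ∷ qs) ⊙ (r ∷ rs) ⊙ f ∎
    where
    p = a + d * 3 * K
    q = a + d + d * 3 * K
    r = a + d + d + d * 3 * K
    ps = progression a (d * 3) K
    qs = progression (a + d) (d * 3) K
    rs = progression (a + d + d) (d * 3) K
    eq₀ : ∀ a d K → a + d * (K * 3) ≡ a + d * 3 * K
    eq₀ = solve-∀
    eq₁ : ∀ a d K → a + d * suc (K * 3) ≡ a + d + d * 3 * K
    eq₁ = solve-∀
    eq₂ : ∀ a d K → a + d * suc (suc (K * 3)) ≡ a + d + d + d * 3 * K
    eq₂ = solve-∀

  ∏ : ℕ → ℕ → Series → Series
  ∏ a d f = progression a d N ⊙ f

  ∏-halves : ∀ a d f → 1 ≤ d → ∏ a d f ≈ ∏ a (d * 2) (∏ (a + d) (d * 2) f)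
  ∏-halves a d f 1≤d = ≈-trans (≈-sym (progression-stable a f 1≤d (m≤m*n N 2))) (progression-halves a d N f)

  ∏-thirds : ∀ a d f → 1 ≤ d →
    ∏ a d f ≈ ∏ a (d * 3) (∏ (a + d) (d * 3) (∏ (a + d + d) (d * 3) f))
  ∏-thirds a d f 1≤d = ≈-trans (≈-sym (progression-stable a f 1≤d (m≤m*n N 3))) (progression-thirds a d N f)

  -- Euler's identity by telescoping

  -- The product of 1 + X^(Mm) over j < m ≤ K. Modulo 2 it is (q^M; q^M)_K / (q^M; q^M)_j, which is
  -- how the denominators of Euler's series are absorbed.
  tail : ℕ → ℕ → ℕ → Series
  tail M K j = progression (M * suc j) M (K ∸ j) ⊙ 1s

  tail-step : ∀ M {K} j → j < K → tail M K j ≈ 1+X^ (M * suc j) · tail M K (suc j)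
  tail-step M {suc K} j (s≤s j≤K) = begin
    progression (M * suc j) M (suc K ∸ j) ⊙ 1s
      ≡⟨ cong (λ k → progression (M * suc j) M k ⊙ 1s) (+-∸-assoc 1 j≤K) ⟩
    progression (M * suc j) M (suc (K ∸ j)) ⊙ 1s
      ≈⟨ progression-first (M * suc j) M (K ∸ j) 1s ⟩
    1+X^ (M * suc j) · progression (M * suc j + M) M (K ∸ j) ⊙ 1s
      ≡⟨ cong (λ k → 1+X^ (M * suc j) · progression k M (K ∸ j) ⊙ 1s) (eq M j) ⟩
    1+X^ (M * suc j) · progression (M * suc (suc j)) M (K ∸ j) ⊙ 1s ∎
    where
    eq : ∀ M j → M * suc j + M ≡ M * suc (suc j)
    eq = solve-∀

  θ : ℕ → ℕ → (ℕ → ℕ) → Series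
  θ M K y = ∑ (suc K) λ j → X^ y j · tail M K j

  -- In characteristic 2, consecutive terms combine because 1 + (1 + X^(M(j+1))) = X^(M(j+1)).
  telescope : ∀ M K (y : ℕ → ℕ) J → J ≤ K →
    ∑ (suc J) (λ j → X^ y (suc j) · tail M K j ⊕ X^ (y j + M * j) · tail M K j) ≈
    ∑ (suc J) (λ j → X^ y j · tail M K j) ⊕ X^ y (suc J) · tail M K J
  telescope M K y zero _ = ≈-trans (⊕-cong ≈-refl (≈-trans (⊕-comm (X^ y 1 · T) _)
    (⊕-cong (X-≡ T (trans (cong (y 0 +_) (*-zeroʳ M)) (+-identityʳ (y 0)))) ≈-refl)))
    (≈-sym (⊕-assoc 0s _ _))
    where T = tail M K 0
  telescope M K y (suc J) J<K = begin
    ∑ (suc J) _ ⊕ (r ⊕ q)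
      ≈⟨ ⊕-cong (telescope M K y J (<⇒≤ J<K)) ≈-refl ⟩
    (s ⊕ X^ y (suc J) · tail M K J) ⊕ (r ⊕ q)
      ≈⟨ ⊕-cong (⊕-cong ≈-refl (≈-trans (X-cong (y (suc J)) (tail-step M J J<K))
           (X-1+X (y (suc J)) (M * suc J) T))) ≈-refl ⟩
    (s ⊕ (p ⊕ q)) ⊕ (r ⊕ q)
      ≈⟨ ⊕-cong (⊕-assoc s p q) ≈-refl ⟨
    ((s ⊕ p) ⊕ q) ⊕ (r ⊕ q)
      ≈⟨ ⊕-cancel (s ⊕ p) q r ⟩
    (s ⊕ p) ⊕ r ∎
    where
    T = tail M K (suc J)
    s = ∑ (suc J) λ j → X^ y j · tail M K j
    p = X^ y (suc J) · T
    q = X^ (y (suc J) + M * suc J) · T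
    r = X^ y (suc (suc J)) · T

  -- Stopping the sum at K leaves one boundary term, with monomial X^(y (K + 1)); the hypothesis
  -- puts it beyond the precision.
  telescope-θ : ∀ M K (y : ℕ → ℕ) → N ≤ y (suc K) →
    ∑ (suc K) (λ j → X^ y (suc j) · tail M K j ⊕ X^ (y j + M * j) · tail M K j) ≈ θ M K y
  telescope-θ M K y N≤y = ≈-trans (telescope M K y K ≤-refl)
    (≈-trans (⊕-cong ≈-refl (X-vanish (tail M K K) N≤y)) (⊕-identityʳ _))

  1+X-θ : ∀ M K c (x : ℕ → ℕ) → 1+X^ c · θ M K x ≈
    ∑ (suc K) λ j → X^ x j · tail M K j ⊕ X^ (c + x j) · tail M K j
  1+X-θ M K c x = ≈-trans (∑-⊙ (c ∷ []) (suc K) _)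
    (∑-cong (suc K) λ j _ → 1+X-X c (x j) (tail M K j))

  -- The functional equation F(x) = (1 + x) F(x q^M) of the product of all 1 + x q^(Mi), at x = q^a.
  euler-step : ∀ M {K} a → 1 ≤ a → N ≤ K →
    θ M K (quad M a) ≈ 1+X^ a · θ M K (quad M (a + M))
  euler-step M {K} a 1≤a N≤K = ≈-sym (≈-trans (1+X-θ M K a (quad M (a + M)))
    (≈-trans (∑-cong (suc K) λ j _ → ≈-trans (⊕-comm _ _)
      (⊕-cong (X-≡ (tail M K j) (quad-shift′ M a j)) (X-≡ (tail M K j) (quad-shift M a j))))
    (telescope-θ M K (quad M a) (≤-trans N≤K (≤-trans (n≤1+n K) (k≤quad M (suc K) 1≤a))))))

  euler-iterate : ∀ M {K} a P → 1 ≤ a → N ≤ K →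
    θ M K (quad M a) ≈ progression a M P ⊙ θ M K (quad M (a + M * P))
  euler-iterate M {K} a zero 1≤a N≤K rewrite *-zeroʳ M | +-identityʳ a = ≈-refl
  euler-iterate M {K} a (suc P) 1≤a N≤K = begin
    θ M K (quad M a)
      ≈⟨ euler-iterate M a P 1≤a N≤K ⟩
    progression a M P ⊙ θ M K (quad M (a + M * P))
      ≈⟨ ⊙-cong (progression a M P) (euler-step M (a + M * P) (≤-trans 1≤a (m≤m+n a _)) N≤K) ⟩
    progression a M P ⊙ 1+X^ (a + M * P) · θ M K (quad M (a + M * P + M))
      ≈⟨ ⊙-1+X (progression a M P) (a + M * P) _ ⟩
    progression a M (suc P) ⊙ θ M K (quad M (a + M * P + M))
      ≡⟨ cong (λ b → progression a M (suc P) ⊙ θ M K (quad M b)) (eq M a P) ⟩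
    progression a M (suc P) ⊙ θ M K (quad M (a + M * suc P)) ∎
    where
    eq : ∀ M a P → a + M * P + M ≡ a + M * suc P
    eq = solve-∀

  -- The end of the iteration: every exponent of index at least 1 contains the summand `a`, so only
  -- the term of index 0 survives.
  θ-high : ∀ M K {a} → N ≤ a → θ M K (quad M a) ≈ tail M K 0
  θ-high M K {a} N≤a = ≈-trans (∑-split-first K _) (≈-trans
    (⊕-cong ≈-refl (∑-0 K λ j → X-vanish (tail M K (suc j))
      (≤-trans N≤a (≤-trans (m≤m+n a (M * j)) (m≤n+m _ (quad M a j))))))
    (≈-trans (⊕-identityʳ _) (exact (X^0 (tail M K 0)))))

  tail-∏ : ∀ M {K} → 1 ≤ M → N ≤ K → tail M K 0 ≈ ∏ M M 1s
  tail-∏ M {K} 1≤M N≤K rewrite *-identityʳ M = progression-stable M 1s 1≤M N≤K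

  euler : ∀ {M K a} → 1 ≤ M → 1 ≤ a → N ≤ K → θ M K (quad M a) ≈ ∏ a M (∏ M M 1s)
  euler {M} {K} {a} 1≤M 1≤a N≤K = begin
    θ M K (quad M a)              ≈⟨ euler-iterate M a N 1≤a N≤K ⟩
    ∏ a M (θ M K (quad M (a + M * N)))
      ≈⟨ ⊙-cong (progression a M N) (θ-high M K (≤-trans (N≤MN 1≤M) (m≤n+m (M * N) a))) ⟩
    ∏ a M (tail M K 0)            ≈⟨ ⊙-cong (progression a M N) (tail-∏ M 1≤M N≤K) ⟩
    ∏ a M (∏ M M 1s)              ∎

  -- The triple product

  jacobi-step : ∀ {K a} b P → 1 ≤ a → P ≤ N → N + N ≤ K →
    1+X^ (b + (a + b) * P) · θ (a + b) K (bilateral a b P) ≈ θ (a + b) K (bilateral a b (suc P))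
  jacobi-step {K} {a} b P 1≤a P≤N 2N≤K = ≈-trans (1+X-θ M K (b + M * P) (bilateral a b P))
    (≈-trans (∑-cong (suc K) λ j _ → ⊕-cong ≈-refl (X-≡ (tail M K j) (bilateral-shift a b P j)))
    (telescope-θ M K (bilateral a b (suc P)) (+-cancelˡ-≤ N N _ (≤-trans 2N≤K
      (≤-trans (j≤P+bilateral b P K 1≤a) (+-monoˡ-≤ (bilateral a b P K) P≤N))))))
    where M = a + b

  jacobi-iterate : ∀ {K a} b P → 1 ≤ a → P ≤ N → N + N ≤ K →
    progression b (a + b) P ⊙ θ (a + b) K (quad (a + b) a) ≈ θ (a + b) K (bilateral a b P)
  jacobi-iterate b zero    1≤a P≤N 2N≤K = ≈-refl
  jacobi-iterate {K} {a} b (suc P) 1≤a P<N 2N≤K =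
    ≈-trans (1+X-cong (b + (a + b) * P) (jacobi-iterate b P 1≤a (<⇒≤ P<N) 2N≤K))
            (jacobi-step b P 1≤a (<⇒≤ P<N) 2N≤K)

∑-at-0 : ∀ (t : ℕ → Series) n J → (∀ j → t j n ≡ 0ℙ) → ∑ J t n ≡ 0ℙ
∑-at-0 t n zero    e = refl
∑-at-0 t n (suc J) e = trans (⊕-coeff (∑ J t) (t J) n) (cong₂ _+ₚ_ (∑-at-0 t n J e) (e J))

-- Each tail is 1 modulo X^((a + b)(j + 1)), and by `X-raise` the monomial in front lifts this
-- precision beyond N. What remains is a sum of monomials, none of which is X^n.
θ-bilateral-vanish : ∀ {N n K a b} → 1 ≤ a → 1 ≤ b → n < N →
  (∀ k → quad (a + b) a k ≢ n) → (∀ k → quad (a + b) b k ≢ n) →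
  Truncated.θ N (a + b) K (bilateral a b N) n ≡ 0ℙ
θ-bilateral-vanish {N} {n} {K} {a} {b} 1≤a 1≤b n<N ≢a ≢b = ∑-at-0 _ n (suc K) λ j →
  trans (coeff (X-raise (bilateral a b N j) (tail≈1 j)) n
          (<-trans n<N (P<bilateral N j 1≤a 1≤b)))
        (X-1 (bilateral a b N j) n (bilateral-avoids a b N j ≢a ≢b))
  where
  tail≈1 : ∀ j → Truncated.tail N (a + b) K j ≈[ (a + b) * suc j ] 1s
  tail≈1 j = Truncated.progression-high _ (a + b) (K ∸ j) 1s ≤-refl

-- Euler's identity trades the factors for a and for a + b for a sum `θ`; the factors for b then
-- extend its index range to negative k.
jacobi-vanish : ∀ {N n a b} → 1 ≤ a → 1 ≤ b → n < N →
  (∀ k → quad (a + b) a k ≢ n) → (∀ k → quad (a + b) b k ≢ n) →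
  Truncated.∏ N b (a + b) (Truncated.∏ N a (a + b) (Truncated.∏ N (a + b) (a + b) 1s)) n ≡ 0ℙ
jacobi-vanish {N} {n} {a} {b} 1≤a 1≤b n<N ≢a ≢b =
  trans (coeff product≈θ n n<N) (θ-bilateral-vanish {K = N + N} 1≤a 1≤b n<N ≢a ≢b)
  where
  open Truncated N
  product≈θ : ∏ b (a + b) (∏ a (a + b) (∏ (a + b) (a + b) 1s)) ≈ θ (a + b) (N + N) (bilateral a b N)
  product≈θ = ≈-trans
    (⊙-cong (progression b (a + b) N) (≈-sym (euler (≤-trans 1≤a (m≤m+n a b)) 1≤a (m≤m+n N N))))
    (jacobi-iterate b N 1≤a ≤-refl ≤-refl)

-- The generating function as a sum of two triple products

quad-square : ∀ j → quad 2 1 j ≡ j * j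
quad-square zero    = refl
quad-square (suc j) = trans (cong (_+ (1 + 2 * j)) (quad-square j)) (eq j)
  where
  eq : ∀ j → j * j + (1 + 2 * j) ≡ suc j * suc j
  eq = solve-∀

-- The product over the parts at most 4 L that are allowed for j, for j ≤ L.
c3-term : ℕ → ℕ → Series
c3-term L j = progression 1 2 (L * 2) ⊙ progression 2 2 j ⊙ progression (4 * j + 4) 4 (L ∸ j) ⊙ 1s

c3-series : ℕ → Series
c3-series L = ∑ L λ j → X^ (suc j * suc j) · c3-term L (suc j)

module _ (N : ℕ) where
  open Truncated N
  open SetoidReasoning ≈-setoid

  -- Each factor 1 + X^(4m) with m > j is two copies of 1 + X^(2m). One copy continues the even
  -- factors from 2j up to 2L, the other belongs to the tail, so that only the tail still depends on
  -- j.
  c3-term-tail : ∀ {L j} → j ≤ L →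
    c3-term L j ≈ progression 1 2 (L * 2) ⊙ progression 2 2 L ⊙ tail 2 L j
  c3-term-tail {L} {j} j≤L = ⊙-cong (progression 1 2 (L * 2)) (begin
    evens j ⊙ progression (4 * j + 4) 4 r ⊙ 1s
      ≡⟨ cong (λ a → evens j ⊙ progression a 4 r ⊙ 1s) (eq₁ j) ⟩
    evens j ⊙ progression (2 * suc j + 2 * suc j) 4 r ⊙ 1s
      ≈⟨ ⊙-cong (evens j) (progression-square (2 * suc j) 2 r 1s) ⟨
    evens j ⊙ progression (2 * suc j) 2 r ⊙ tail 2 L j
      ≈⟨ ⊙-comm (evens j) (progression (2 * suc j) 2 r) (tail 2 L j) ⟩
    progression (2 * suc j) 2 r ⊙ evens j ⊙ tail 2 L j
      ≡⟨ cong (λ a → progression a 2 r ⊙ evens j ⊙ tail 2 L j) (eq₂ j) ⟩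
    progression (2 + 2 * j) 2 r ⊙ evens j ⊙ tail 2 L j
      ≈⟨ progression-++ 2 2 j r (tail 2 L j) ⟨
    evens (r + j) ⊙ tail 2 L j
      ≡⟨ cong (λ l → evens l ⊙ tail 2 L j) (m∸n+n≡m j≤L) ⟩
    evens L ⊙ tail 2 L j ∎)
    where
    r = L ∸ j
    evens = progression 2 2
    eq₁ : ∀ j → 4 * j + 4 ≡ 2 * suc j + 2 * suc j
    eq₁ = solve-∀
    eq₂ : ∀ j → 2 * suc j ≡ 2 + 2 * j
    eq₂ = solve-∀

  ∏∏ : Series → Series
  ∏∏ f = ∏ 1 2 (∏ 2 2 f)

  ∏∏-cong : ∀ {f g} → f ≈ g → ∏∏ f ≈ ∏∏ g
  ∏∏-cong f≈g = ⊙-cong (progression 1 2 N) (⊙-cong (progression 2 2 N) f≈g)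

  -- The term of index 0 is the bare tail, and in characteristic 2 it is removed by adding it once
  -- more.
  θ-without-first : ∀ M K y → y 0 ≡ 0 →
    ∑ K (λ j → X^ y (suc j) · tail M K (suc j)) ≈ θ M K y ⊕ tail M K 0
  θ-without-first M K y y0≡0 = ≈-sym (begin
    θ M K y ⊕ t                 ≈⟨ ⊕-cong (∑-split-first K _) ≈-refl ⟩
    (X^ y 0 · t ⊕ s) ⊕ t        ≈⟨ ⊕-cong
      (≈-trans (⊕-cong (≈-trans (X-≡ t y0≡0) (exact (X^0 t))) ≈-refl) (⊕-comm t s))
      (≈-sym (≈-trans (⊕-comm 0s t) (⊕-identityʳ t))) ⟩
    (s ⊕ t) ⊕ (0s ⊕ t)          ≈⟨ ⊕-cancel s t 0s ⟩
    s ⊕ 0s                      ≈⟨ ⊕-identityʳ s ⟩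
    s                           ∎)
    where
    t = tail M K 0
    s = ∑ K λ j → X^ y (suc j) · tail M K (suc j)

  c3-series-∏ : ∀ {L} → N ≤ L → c3-series L ≈ ∏∏ (∏∏ 1s) ⊕ ∏∏ (∏ 2 2 1s)
  c3-series-∏ {L} N≤L = begin
    c3-series L
      ≈⟨ ∑-cong L (λ j j<L → ≈-trans
           (X-cong (suc j * suc j) (≈-trans (c3-term-tail j<L) (⊙-stable (tail 2 L (suc j)))))
           (≈-sym (≈-trans (⊙-cong (progression 1 2 N) (⊙-X (progression 2 2 N) _ _))
             (≈-trans (⊙-X (progression 1 2 N) _ _) (X-≡ _ (quad-square (suc j))))))) ⟩
    ∑ L (λ j → ∏∏ (X^ quad 2 1 (suc j) · tail 2 L (suc j)))
      ≈⟨ ≈-trans (⊙-cong (progression 1 2 N) (∑-⊙ (progression 2 2 N) L _))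
           (∑-⊙ (progression 1 2 N) L _) ⟨
    ∏∏ (∑ L (λ j → X^ quad 2 1 (suc j) · tail 2 L (suc j)))
      ≈⟨ ∏∏-cong (≈-trans (θ-without-first 2 L (quad 2 1) refl)
           (⊕-cong (euler (s≤s z≤n) (s≤s z≤n) N≤L) (tail-∏ 2 (s≤s z≤n) N≤L))) ⟩
    ∏∏ (∏∏ 1s ⊕ ∏ 2 2 1s)
      ≈⟨ ≈-trans (⊙-cong (progression 1 2 N) (⊙-⊕ (progression 2 2 N) _ _))
           (⊙-⊕ (progression 1 2 N) _ _) ⟩
    ∏∏ (∏∏ 1s) ⊕ ∏∏ (∏ 2 2 1s) ∎
    where
    ⊙-stable : ∀ f → progression 1 2 (L * 2) ⊙ progression 2 2 L ⊙ f ≈ ∏∏ f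
    ⊙-stable f = ≈-trans
      (progression-stable 1 _ (s≤s z≤n) (≤-trans N≤L (m≤m*n L 2)))
      (⊙-cong (progression 1 2 N) (progression-stable 2 f (s≤s z≤n) N≤L))

  -- O² has the exponents 2 modulo 4 and E² the multiples of 4; together these are all even
  -- exponents, so (O E)² = E. Their classes 2, 4 and 0 modulo 6 form the triple product.
  ∏∏∏∏≈∏³ : ∏∏ (∏∏ 1s) ≈ ∏ 2 6 (∏ 4 6 (∏ 6 6 1s))
  ∏∏∏∏≈∏³ = begin
    ∏ 1 2 (∏ 2 2 (∏ 1 2 (∏ 2 2 1s)))
      ≈⟨ ⊙-cong (progression 1 2 N) (⊙-comm (progression 2 2 N) (progression 1 2 N) _) ⟩
    ∏ 1 2 (∏ 1 2 (∏ 2 2 (∏ 2 2 1s)))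
      ≈⟨ progression-square 1 2 N _ ⟩
    ∏ 2 4 (∏ 2 2 (∏ 2 2 1s))
      ≈⟨ ⊙-cong (progression 2 4 N) (progression-square 2 2 N 1s) ⟩
    ∏ 2 4 (∏ 4 4 1s)
      ≈⟨ ∏-halves 2 2 1s (s≤s z≤n) ⟨
    ∏ 2 2 1s
      ≈⟨ ∏-thirds 2 2 1s (s≤s z≤n) ⟩
    ∏ 2 6 (∏ 4 6 (∏ 6 6 1s)) ∎

  -- E² supplies the multiples of 4, and O splits into the classes 1 and 3 modulo 4.
  ∏∏∏≈∏³ : ∏∏ (∏ 2 2 1s) ≈ ∏ 1 4 (∏ 3 4 (∏ 4 4 1s))
  ∏∏∏≈∏³ = begin
    ∏ 1 2 (∏ 2 2 (∏ 2 2 1s))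
      ≈⟨ ⊙-cong (progression 1 2 N) (progression-square 2 2 N 1s) ⟩
    ∏ 1 2 (∏ 4 4 1s)
      ≈⟨ ∏-halves 1 2 _ (s≤s z≤n) ⟩
    ∏ 1 4 (∏ 3 4 (∏ 4 4 1s)) ∎

c3-series-vanish : ∀ {n L} → n < L →
  (∀ k → quad 6 2 k ≢ n) → (∀ k → quad 6 4 k ≢ n) →
  (∀ k → quad 4 1 k ≢ n) → (∀ k → quad 4 3 k ≢ n) → c3-series L n ≡ 0ℙ
c3-series-vanish {n} {L} n<L ≢2 ≢4 ≢1 ≢3 =
  trans (coeff (≈-trans (c3-series-∏ L ≤-refl) (⊕-cong (∏∏∏∏≈∏³ L) (∏∏∏≈∏³ L))) n n<L)
  (trans (⊕-coeff _ _ n) (cong₂ _+ₚ_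
    (jacobi-vanish {L} {n} {4} {2} (s≤s z≤n) (s≤s z≤n) n<L ≢4 ≢2)
    (jacobi-vanish {L} {n} {3} {1} (s≤s z≤n) (s≤s z≤n) n<L ≢3 ≢1)))
  where open Truncated L

-- Residues modulo 11

-- Eleven increments add 11a + 11Mk + M(0 + 1 + ... + 10); the last summand is 55M, whence `5 * M`.
quad-periodic : ∀ M a k → quad M a (11 + k) % 11 ≡ quad M a k % 11
quad-periodic M a k = trans (cong (_% 11) (eq (quad M a k) M a k))
  ([m+kn]%n≡m%n (quad M a k) (a + M * k + 5 * M) 11)
  where
  eq : ∀ q M a k →
    q + (a + M * k) + (a + M * (1 + k)) + (a + M * (2 + k)) + (a + M * (3 + k)) + (a + M * (4 + k)) +
    (a + M * (5 + k)) + (a + M * (6 + k)) + (a + M * (7 + k)) + (a + M * (8 + k)) + (a + M * (9 + k)) +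
    (a + M * (10 + k)) ≡ q + (a + M * k + 5 * M) * 11
  eq = solve-∀

quad-mod : ∀ M a k → quad M a k % 11 ≡ quad M a (k % 11) % 11
quad-mod M a k = trans (cong (λ i → quad M a i % 11) (m≡m%n+[m/n]*n k 11)) (periods (k / 11))
  where
  periods : ∀ m → quad M a (k % 11 + m * 11) % 11 ≡ quad M a (k % 11) % 11
  periods zero    = cong (λ i → quad M a i % 11) (+-identityʳ (k % 11))
  periods (suc m) = trans (cong (λ i → quad M a i % 11) (eq (k % 11) m))
    (trans (quad-periodic M a (k % 11 + m * 11)) (periods m))
    where
    eq : ∀ k m → k + suc m * 11 ≡ 11 + (k + m * 11)
    eq = solve-∀

-- By `quad-mod` one period of k decides the matter, so this finite form can be settled by
-- evaluation.
QuadMisses : ℕ → ℕ → ℕ → Set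
QuadMisses r M a = ∀ {k} → k < 11 → quad M a k % 11 ≢ r

quadMisses? : ∀ r M a → Dec (QuadMisses r M a)
quadMisses? r M a = allUpTo? (λ k → ¬? (quad M a k % 11 ≟ r)) 11

quad-≢ : ∀ {r M a} n → r < 11 → QuadMisses r M a → ∀ k → quad M a k ≢ 11 * n + r
quad-≢ {r} {M} {a} n r<11 misses k e = misses (m%n<n k 11)
  (trans (sym (quad-mod M a k)) (trans (cong (_% 11) (trans e (eq n r)))
    (trans ([m+kn]%n≡m%n r n 11) (m<n⇒m%n≡m r<11))))
  where
  eq : ∀ n r → 11 * n + r ≡ r + n * 11
  eq = solve-∀

-- Enumerating partitions into distinct admissible parts

module _ {A : Set} where

  ∈-shift⁻ : ∀ m {f : ℕ → List A} n {x} → x ∈ shift [] m f n → ∃ λ r → m + r ≡ n × x ∈ f r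
  ∈-shift⁻ zero    n       x∈ = n , refl , x∈
  ∈-shift⁻ (suc m) (suc n) x∈ with r , e , x∈f ← ∈-shift⁻ m n x∈ = r , cong suc e , x∈f

  ∈-shift⁺ : ∀ m {f : ℕ → List A} r {x} → x ∈ f r → x ∈ shift [] m f (m + r)
  ∈-shift⁺ zero    r x∈ = x∈
  ∈-shift⁺ (suc m) r x∈ = ∈-shift⁺ m r x∈

  shift-unique : ∀ m {f : ℕ → List A} n → (∀ r → Unique (f r)) → Unique (shift [] m f n)
  shift-unique zero    n       u = u n
  shift-unique (suc m) zero    u = []
  shift-unique (suc m) (suc n) u = shift-unique m n u

  shift-parity : ∀ m {f : ℕ → List A} {g : Series} n → (∀ r → parity (length (f r)) ≡ g r) →
    parity (length (shift [] m f n)) ≡ shift 0ℙ m g n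
  shift-parity zero    n       e = e n
  shift-parity (suc m) zero    e = refl
  shift-parity (suc m) (suc n) e = shift-parity m n e

even⇒2∣ : ∀ n → parity n ≡ 0ℙ → 2 ∣ n
even⇒2∣ zero          e = divides 0 refl
even⇒2∣ (suc (suc n)) e = ∣m∣n⇒∣m+n {m = 2} (divides 1 refl) (even⇒2∣ n e)

module StrictPartitions {A : ℕ → Set} (A? : ∀ k → Dec (A k)) where

  parts : ℕ → List ℕ
  parts zero    = []
  parts (suc k) = if does (A? (suc k)) then suc k ∷ parts k else parts k

  parts-yes : ∀ k → A (suc k) → parts (suc k) ≡ suc k ∷ parts k
  parts-yes k a rewrite dec-true (A? (suc k)) a = refl

  parts-no : ∀ k → ¬ A (suc k) → parts (suc k) ≡ parts k
  parts-no k ¬a rewrite dec-false (A? (suc k)) ¬a = refl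

  strict : ℕ → ℕ → List (List ℕ)
  strict zero    zero    = [] ∷ []
  strict zero    (suc n) = []
  strict (suc k) n with A? (suc k)
  ... | yes _ = strict k n ++ map (suc k ∷_) (shift [] (suc k) (strict k) n)
  ... | no _  = strict k n

  IsPart : ℕ → Set
  IsPart x = 1 ≤ x × A x

  IsStrict : ℕ → ℕ → List ℕ → Set
  IsStrict k n q = AllPairs _>_ q × All IsPart q × All (_≤ k) q × sum q ≡ n

  strict-sound : ∀ k n {q} → q ∈ strict k n → IsStrict k n q
  strict-sound zero zero (here refl) = [] , [] , [] , refl
  strict-sound (suc k) n q∈ with A? (suc k)
  ... | no _ with d , p , b , s ← strict-sound k n q∈ = d , p , All.map m≤n⇒m≤1+n b , s
  ... | yes a with ∈-++⁻ (strict k n) q∈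
  ...   | inj₁ q∈ˡ with d , p , b , s ← strict-sound k n q∈ˡ = d , p , All.map m≤n⇒m≤1+n b , s
  ...   | inj₂ q∈ʳ with q′ , q′∈ , refl ← ∈-map⁻ (suc k ∷_) q∈ʳ
                   with r , e , q′∈r ← ∈-shift⁻ (suc k) n q′∈
                   with d , p , b , s ← strict-sound k r q′∈r =
    All.map s≤s b ∷ d , (s≤s z≤n , a) ∷ p , ≤-refl ∷ All.map m≤n⇒m≤1+n b ,
    trans (cong (suc k +_) s) e

  strict-weaken : ∀ k n {q} → q ∈ strict k n → q ∈ strict (suc k) n
  strict-weaken k n q∈ with A? (suc k)
  ... | yes _ = ∈-++⁺ˡ q∈
  ... | no _  = q∈

  strict-∷ : ∀ k r {q} → A (suc k) → q ∈ strict k r → suc k ∷ q ∈ strict (suc k) (suc k + r)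
  strict-∷ k r a q∈ with A? (suc k)
  ... | yes _ = ∈-++⁺ʳ (strict k (suc k + r)) (∈-map⁺ (suc k ∷_) (∈-shift⁺ (suc k) r q∈))
  ... | no ¬a = contradiction a ¬a

  strict-complete : ∀ k n {q} → IsStrict k n q → q ∈ strict k n
  strict-complete zero n {[]} (_ , _ , _ , refl) = here refl
  strict-complete zero n {zero ∷ q} (_ , (() , _) ∷ _ , _)
  strict-complete zero n {suc x ∷ q} (_ , _ , () ∷ _ , _)
  strict-complete (suc k) n {[]} (d , p , b , s) = strict-weaken k n (strict-complete k n (d , p , [] , s))
  strict-complete (suc k) n {x ∷ q} (x>q ∷ d , (1≤x , a) ∷ p , x≤1+k ∷ b , s) with x ≟ suc k
  ... | yes refl = subst (λ n → x ∷ q ∈ strict x n) s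
    (strict-∷ k (sum q) a (strict-complete k (sum q) (d , p , All.map ≤-pred x>q , refl)))
  ... | no x≢1+k = strict-weaken k n (strict-complete k n
    (x>q ∷ d , (1≤x , a) ∷ p , x≤k ∷ All.map (λ y<x → ≤-trans (<⇒≤ y<x) x≤k) x>q , s))
    where
    x≤k : x ≤ k
    x≤k = ≤-pred (≤∧≢⇒< x≤1+k x≢1+k)

  strict-unique : ∀ k n → Unique (strict k n)
  strict-unique zero    zero    = [] ∷ []
  strict-unique zero    (suc n) = []
  strict-unique (suc k) n with A? (suc k)
  ... | no _  = strict-unique k n
  ... | yes _ = Unique.++⁺ (strict-unique k n)
    (Unique.map⁺ ∷-injectiveʳ (shift-unique (suc k) n (strict-unique k)))
    λ (q∈ˡ , q∈ʳ) → disjoint q∈ˡ (∈-map⁻ (suc k ∷_) q∈ʳ)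
    where
    disjoint : ∀ {q} → q ∈ strict k n → (∃ λ q′ → q′ ∈ shift [] (suc k) (strict k) n × q ≡ suc k ∷ q′) → ⊥
    disjoint q∈ (_ , _ , refl) with (_ , _ , 1+k≤k ∷ _ , _) ← strict-sound k n q∈ = 1+n≰n 1+k≤k

  -- The partitions without and with the part k + 1 correspond to the two terms of 1 + X^(k + 1);
  -- both recursions branch on the same decision `A? (suc k)`.
  strict-parity : ∀ k n → parity (length (strict k n)) ≡ (parts k ⊙ 1s) n
  strict-parity zero    zero    = refl
  strict-parity zero    (suc n) = refl
  strict-parity (suc k) n with A? (suc k)
  ... | no _  = strict-parity k n
  ... | yes _ = begin
    parity (length (strict k n ++ map (suc k ∷_) (shift [] (suc k) (strict k) n)))
      ≡⟨ cong parity (trans (length-++ (strict k n))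
           (cong (length (strict k n) +_) (length-map _ (shift [] (suc k) (strict k) n)))) ⟩
    parity (length (strict k n) + length (shift [] (suc k) (strict k) n))
      ≡⟨ ℙ.+-homo-+ (length (strict k n)) _ ⟩
    parity (length (strict k n)) +ₚ parity (length (shift [] (suc k) (strict k) n))
      ≡⟨ cong₂ _+ₚ_ (strict-parity k n) (trans (shift-parity (suc k) n (strict-parity k))
           (sym (X-coeff (suc k) (parts k ⊙ 1s) n))) ⟩
    (parts k ⊙ 1s) n +ₚ (X^ suc k · parts k ⊙ 1s) n
      ≡⟨ ⊕-coeff _ _ n ⟨
    (1+X^ suc k · parts k ⊙ 1s) n ∎
    where open ≡-Reasoning

-- The allowed parts and their product

-- For even numbers the last two alternatives leave out 2j + 2, ..., 4j + 2, which lie above 2j and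
-- below 4j + 4.
Allowed : ℕ → ℕ → Set
Allowed j x = ¬ (2 ∣ x) ⊎ x ≤ 2 * j ⊎ (4 * j + 4 ≤ x × 4 ∣ x)

allowed? : ∀ j x → Dec (Allowed j x)
allowed? j x = ¬? (2 ∣? x) ⊎-dec (x ≤? 2 * j) ⊎-dec ((4 * j + 4 ≤? x) ×-dec (4 ∣? x))

open module Strict j = StrictPartitions (allowed? j)

2∤1 : ¬ (2 ∣ 1)
2∤1 2∣1 with s≤s () ← ∣⇒≤ 2∣1

2∤odd : ∀ k → ¬ (2 ∣ suc (k * 2))
2∤odd k d = 2∤1 (∣m+n∣m⇒∣n (subst (2 ∣_) (+-comm 1 (k * 2)) d) (n∣m*n k))

4∤2 : ¬ (4 ∣ 2)
4∤2 4∣2 with s≤s (s≤s ()) ← ∣⇒≤ 4∣2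

4∤4k+2 : ∀ k → ¬ (4 ∣ suc (suc (k * 2 * 2)))
4∤4k+2 k d = 4∤2 (∣m+n∣m⇒∣n (subst (4 ∣_) (eq k) d) (n∣m*n k))
  where
  eq : ∀ k → suc (suc (k * 2 * 2)) ≡ k * 4 + 2
  eq = solve-∀

module _ (N : ℕ) where
  open Truncated N
  open SetoidReasoning ≈-setoid

  ⊙-odd : ∀ j k f → parts j (suc (k * 2)) ⊙ f ≈ 1+X^ suc (k * 2) · parts j (k * 2) ⊙ f
  ⊙-odd j k f rewrite parts-yes j (k * 2) (inj₁ (2∤odd k)) = ≈-refl

  ⊙-even : ∀ j k f → Allowed j (suc k * 2) →
    parts j (suc k * 2) ⊙ f ≈ 1+X^ (suc k * 2) · 1+X^ suc (k * 2) · parts j (k * 2) ⊙ f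
  ⊙-even j k f a rewrite parts-yes j (suc (k * 2)) a = 1+X-cong (suc k * 2) (⊙-odd j k f)

  ⊙-gap : ∀ j k f → ¬ Allowed j (suc k * 2) →
    parts j (suc k * 2) ⊙ f ≈ 1+X^ suc (k * 2) · parts j (k * 2) ⊙ f
  ⊙-gap j k f ¬a rewrite parts-no j (suc (k * 2)) ¬a = ⊙-odd j k f

  odds evens : ℕ → List ℕ
  odds  = progression 1 2
  evens = progression 2 2

  ⊙-next-odd : ∀ k f → 1+X^ suc (k * 2) · odds k ⊙ f ≈ odds (suc k) ⊙ f
  ⊙-next-odd k f = 1+X-≡ _ (cong suc (*-comm k 2))

  parts-≤2j : ∀ j i f → i ≤ j → parts j (i * 2) ⊙ f ≈ odds i ⊙ evens i ⊙ f
  parts-≤2j j zero    f _   = ≈-refl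
  parts-≤2j j (suc i) f i<j = begin
    parts j (suc i * 2) ⊙ f
      ≈⟨ ⊙-even j i f (inj₂ (inj₁ (≤-trans (≤-reflexive (*-comm (suc i) 2)) (*-monoʳ-≤ 2 i<j)))) ⟩
    1+X^ (suc i * 2) · 1+X^ suc (i * 2) · parts j (i * 2) ⊙ f
      ≈⟨ 1+X-cong (suc i * 2) (≈-trans (1+X-cong _ (parts-≤2j j i f (<⇒≤ i<j))) (⊙-next-odd i (evens i ⊙ f))) ⟩
    1+X^ (suc i * 2) · odds (suc i) ⊙ evens i ⊙ f
      ≈⟨ ⊙-1+X (odds (suc i)) (suc i * 2) (evens i ⊙ f) ⟨
    odds (suc i) ⊙ 1+X^ (suc i * 2) · evens i ⊙ f
      ≈⟨ ⊙-cong (odds (suc i)) (1+X-≡ _ (cong (suc ∘ suc) (*-comm i 2))) ⟩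
    odds (suc i) ⊙ evens (suc i) ⊙ f ∎

  -- The even numbers from 2j + 2 to 4j all lie in the gap, so only the odd factors advance.
  parts-≤4j : ∀ j i f → i ≤ j → parts j ((i + j) * 2) ⊙ f ≈ odds (i + j) ⊙ evens j ⊙ f
  parts-≤4j j zero    f _   = parts-≤2j j j f ≤-refl
  parts-≤4j j (suc i) f i<j = begin
    parts j (suc (i + j) * 2) ⊙ f                     ≈⟨ ⊙-gap j (i + j) f not-allowed ⟩
    1+X^ suc ((i + j) * 2) · parts j ((i + j) * 2) ⊙ f ≈⟨ 1+X-cong _ (parts-≤4j j i f (<⇒≤ i<j)) ⟩
    1+X^ suc ((i + j) * 2) · odds (i + j) ⊙ evens j ⊙ f ≈⟨ ⊙-next-odd (i + j) _ ⟩
    odds (suc (i + j)) ⊙ evens j ⊙ f                  ∎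
    where
    not-allowed : ¬ Allowed j (suc (i + j) * 2)
    not-allowed (inj₁ odd) = odd (n∣m*n (suc (i + j)))
    not-allowed (inj₂ (inj₁ le)) = 1+n≰n (≤-trans (s≤s (m≤n+m j i))
      (*-cancelʳ-≤ _ _ 2 (≤-trans le (≤-reflexive (*-comm 2 j)))))
    not-allowed (inj₂ (inj₂ (le , _))) = 1+n≰n (≤-trans (+-monoˡ-≤ j (s≤s i<j))
      (*-cancelʳ-≤ _ _ 2 (≤-trans (m≤m+n _ 2) (≤-trans (≤-reflexive (eq j)) le))))
      where
      eq : ∀ j → (suc j + j) * 2 + 2 ≡ 4 * j + 4
      eq = solve-∀

  -- Past 4j the numbers come in blocks of four: two odd ones, a forbidden one that is 2 modulo 4,
  -- and an allowed multiple of 4. The first block contains the last element 4j + 2 of the gap.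
  parts-≤4L : ∀ j i f → parts j ((i * 2 + (j + j)) * 2) ⊙ f ≈
    odds (i * 2 + (j + j)) ⊙ evens j ⊙ progression (4 * j + 4) 4 i ⊙ f
  parts-≤4L j zero    f = parts-≤4j j j f ≤-refl
  parts-≤4L j (suc i) f = begin
    parts j (suc (suc k) * 2) ⊙ f
      ≈⟨ ⊙-even j (suc k) f (inj₂ (inj₂ (≤-trans (m≤m+n _ (4 * i)) (≤-reflexive (sym (eq i j))) ,
           divides (i + j + 1) (eq₄ i j)))) ⟩
    1+X^ (suc (suc k) * 2) · 1+X^ suc (suc k * 2) · parts j (suc k * 2) ⊙ f
      ≈⟨ 1+X-cong (suc (suc k) * 2) (begin
        1+X^ suc (suc k * 2) · parts j (suc k * 2) ⊙ f
          ≈⟨ 1+X-cong _ (≈-trans (⊙-gap j k f not-allowed) (1+X-cong _ (parts-≤4L j i f))) ⟩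
        1+X^ suc (suc k * 2) · 1+X^ suc (k * 2) · odds k ⊙ evens j ⊙ multiples i ⊙ f
          ≈⟨ ≈-trans (1+X-cong _ (⊙-next-odd k _)) (⊙-next-odd (suc k) _) ⟩
        odds (suc (suc k)) ⊙ evens j ⊙ multiples i ⊙ f ∎) ⟩
    1+X^ (suc (suc k) * 2) · odds (suc (suc k)) ⊙ evens j ⊙ multiples i ⊙ f
      ≈⟨ ≈-trans (⊙-cong (odds (suc (suc k))) (⊙-1+X (evens j) _ _)) (⊙-1+X (odds (suc (suc k))) _ _) ⟨
    odds (suc (suc k)) ⊙ evens j ⊙ 1+X^ (suc (suc k) * 2) · multiples i ⊙ f
      ≈⟨ ⊙-cong (odds (suc (suc k))) (⊙-cong (evens j) (1+X-≡ _ (eq i j))) ⟩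
    odds (suc (suc k)) ⊙ evens j ⊙ multiples (suc i) ⊙ f ∎
    where
    k = i * 2 + (j + j)
    multiples = progression (4 * j + 4) 4
    eq : ∀ i j → suc (suc (i * 2 + (j + j))) * 2 ≡ 4 * j + 4 + 4 * i
    eq = solve-∀
    eq₄ : ∀ i j → suc (suc (i * 2 + (j + j))) * 2 ≡ (i + j + 1) * 4
    eq₄ = solve-∀
    eq₂ : ∀ i j → (i * 2 + (j + j)) * 2 ≡ (i + j) * 2 * 2
    eq₂ = solve-∀
    not-allowed : ¬ Allowed j (suc k * 2)
    not-allowed (inj₁ odd) = odd (n∣m*n (suc k))
    not-allowed (inj₂ (inj₁ le)) = 1+n≰n (≤-trans (s≤s (≤-trans (m≤m+n j j) (m≤n+m (j + j) (i * 2))))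
      (*-cancelʳ-≤ _ _ 2 (≤-trans le (≤-reflexive (*-comm 2 j)))))
    not-allowed (inj₂ (inj₂ (_ , d))) = 4∤4k+2 (i + j) (subst (λ m → 4 ∣ suc (suc m)) (eq₂ i j) d)

  parts-c3-term : ∀ {j L} → j ≤ L → parts j (L * 4) ⊙ 1s ≈ c3-term L j
  parts-c3-term {j} {L} j≤L = begin
    parts j (L * 4) ⊙ 1s
      ≡⟨ cong (λ k → parts j k ⊙ 1s) (trans (sym (*-assoc L 2 2)) (cong (_* 2) (sym 2L))) ⟩
    parts j ((r * 2 + (j + j)) * 2) ⊙ 1s
      ≈⟨ parts-≤4L j r 1s ⟩
    odds (r * 2 + (j + j)) ⊙ evens j ⊙ progression (4 * j + 4) 4 r ⊙ 1s
      ≡⟨ cong (λ k → odds k ⊙ evens j ⊙ progression (4 * j + 4) 4 r ⊙ 1s) 2L ⟩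
    c3-term L j ∎
    where
    r = L ∸ j
    eq : ∀ r j → r * 2 + (j + j) ≡ (r + j) * 2
    eq = solve-∀
    2L : r * 2 + (j + j) ≡ L * 2
    2L = trans (eq r j) (cong (_* 2) (m∸n+n≡m j≤L))

-- Multiplicities and splitting off the ones

mult-here : ∀ k p → mult k (k ∷ p) ≡ suc (mult k p)
mult-here k p with k ≟ k
... | yes _  = refl
... | no k≢k = contradiction refl k≢k

mult-there : ∀ {x k} p → x ≢ k → mult k (x ∷ p) ≡ mult k p
mult-there {x} {k} p x≢k with x ≟ k
... | yes x≡k = contradiction x≡k x≢k
... | no _    = refl

mult-++ : ∀ k p q → mult k (p ++ q) ≡ mult k p + mult k q
mult-++ k []      q = refl
mult-++ k (x ∷ p) q with x ≟ k
... | yes _ = cong suc (mult-++ k p q)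
... | no _  = mult-++ k p q

mult-∷-≤ : ∀ k x p → mult k p ≤ mult k (x ∷ p)
mult-∷-≤ k x p with x ≟ k
... | yes _ = n≤1+n _
... | no _  = ≤-refl

mult≡0⇒≢ : ∀ k p → mult k p ≡ 0 → All (_≢ k) p
mult≡0⇒≢ k []      e = []
mult≡0⇒≢ k (x ∷ p) e with x ≟ k
... | no x≢k = x≢k ∷ mult≡0⇒≢ k p e

≢⇒mult≡0 : ∀ {k p} → All (_≢ k) p → mult k p ≡ 0
≢⇒mult≡0 []          = refl
≢⇒mult≡0 (x≢k ∷ p≢k) = trans (mult-there _ x≢k) (≢⇒mult≡0 p≢k)

mult-replicate : ∀ k m → mult k (replicate m k) ≡ m
mult-replicate k zero    = refl
mult-replicate k (suc m) = trans (mult-here k (replicate m k)) (cong suc (mult-replicate k m))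

mult-strict : ∀ k {q} → AllPairs _>_ q → mult k q ≤ 1
mult-strict k []          = z≤n
mult-strict k {x ∷ q} (x>q ∷ d) with x ≟ k
... | yes refl = s≤s (≤-reflexive (≢⇒mult≡0 (All.map <⇒≢ x>q)))
... | no _     = mult-strict k d

sum-replicate-1 : ∀ m → sum (replicate m 1) ≡ m
sum-replicate-1 zero    = refl
sum-replicate-1 (suc m) = cong suc (sum-replicate-1 m)

parts≤sum : ∀ q → All (_≤ sum q) q
parts≤sum []      = []
parts≤sum (x ∷ q) = m≤m+n x (sum q) ∷ All.map (λ y≤ → ≤-trans y≤ (m≤n+m (sum q) x)) (parts≤sum q)

all-ones : ∀ {p} → All (_≤ 1) p → All (1 ≤_) p → p ≡ replicate (mult 1 p) 1
all-ones {[]}    _          _          = refl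
all-ones {x ∷ p} (x≤1 ∷ b) (1≤x ∷ pos) with refl ← ≤-antisym x≤1 1≤x = cong (1 ∷_) (all-ones b pos)

-- The recursion runs to the first 1; as the list is non-increasing, only ones follow. If there are
-- m + 1 of them, the first becomes the last part of `q`.
split-ones : ∀ m p → AllPairs _≥_ p → All (1 ≤_) p → (∀ k → 1 < k → mult k p ≤ 1) →
  mult 1 p ≡ m ⊎ mult 1 p ≡ m + 1 → ∃ λ q → AllPairs _>_ q × p ≡ q ++ replicate m 1
split-ones m []      _ _ _ (inj₁ refl) = [] , [] , refl
split-ones m []      _ _ _ (inj₂ 0≡m+1) with () ← trans 0≡m+1 (+-comm m 1)
split-ones m (x ∷ p) (x≥p ∷ d) (1≤x ∷ pos) distinct ones with x ≟ 1
split-ones m (x ∷ p) (x≥p ∷ d) (1≤x ∷ pos) distinct (inj₁ refl) | yes refl =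
  [] , [] , cong (1 ∷_) (all-ones x≥p pos)
split-ones m (x ∷ p) (x≥p ∷ d) (1≤x ∷ pos) distinct (inj₂ e) | yes refl =
  1 ∷ [] , [] ∷ [] , cong (1 ∷_) (trans (all-ones x≥p pos)
    (cong (λ i → replicate i 1) (suc-injective (trans e (+-comm m 1)))))
split-ones m (x ∷ p) (x≥p ∷ d) (1≤x ∷ pos) distinct ones | no x≢1
  with q , d′ , refl ← split-ones m p d pos (λ k 1<k → ≤-trans (mult-∷-≤ k x p) (distinct k 1<k)) ones =
  x ∷ q , All.zipWith (λ (y≤x , y≢x) → ≤∧≢⇒< y≤x y≢x) (All.++⁻ˡ q x≥p , All.++⁻ˡ q p≢x) ∷ d′ , refl
  where
  -- A part greater than 1 occurs only once, hence not in the rest of the list; this sharpens ≥ to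
  -- >.
  p≢x : All (_≢ x) p
  p≢x = mult≡0⇒≢ x p (n≤0⇒n≡0 (≤-pred (≤-trans (≤-reflexive (sym (mult-here x p)))
    (distinct x (≤∧≢⇒< 1≤x (x≢1 ∘ sym))))))

-- When 1 has multiplicity j² + 1, the extra 1 is counted in the strict part q.
IsC3 : ℕ → ℕ → List ℕ → Set
IsC3 j n p = ∃ λ q → AllPairs _>_ q × All (IsPart j) q × p ≡ q ++ replicate (j * j) 1 × j * j + sum q ≡ n

C3Cond⇒IsC3 : ∀ {j n p} → IsPartition n p → C3Cond j p → IsC3 j n p
C3Cond⇒IsC3 {j} {n} {p} isPartition cond = isC3 (split-ones (j * j) p
    (Linked.Linked⇒AllPairs (λ x≥y y≥z → ≤-trans y≥z x≥y) nonIncr) positive distinct ones)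
  where
  open IsPartition isPartition
  open C3Cond cond
  distinct : ∀ k → 1 < k → mult k p ≤ 1
  distinct k 1<k with 2 ∣? k
  ... | yes even = evenDistinct k even
  ... | no odd   = oddDistinct k odd 1<k
  allowed : ∀ {x} → x ∈ p → Allowed j x
  allowed {x} x∈p with 2 ∣? x | x ≤? 2 * j
  ... | no odd   | _        = inj₁ odd
  ... | yes _    | yes x≤2j = inj₂ (inj₁ x≤2j)
  ... | yes even | no x≰2j  = inj₂ (inj₂ (largeEven x x∈p even (≰⇒> x≰2j)))
  isC3 : (∃ λ q → AllPairs _>_ q × p ≡ q ++ replicate (j * j) 1) → IsC3 j n p
  isC3 (q , d , refl) =
    q , d , All.tabulate (λ x∈q → All.lookup positive (∈-++⁺ˡ x∈q) , allowed (∈-++⁺ˡ x∈q)) , refl ,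
    trans (+-comm (j * j) (sum q)) (trans (sym (trans
      (sum-++ q (replicate (j * j) 1)) (cong (sum q +_) (sum-replicate-1 (j * j))))) sumEq)

∈-replicate : ∀ {x y : ℕ} m → x ∈ replicate m y → x ≡ y
∈-replicate m x∈ = All.lookup {P = _≡ _} (All.replicate⁺ m refl) x∈

m≤1⇒m≡0∨1 : ∀ {m} → m ≤ 1 → m ≡ 0 ⊎ m ≡ 1
m≤1⇒m≡0∨1 z≤n       = inj₁ refl
m≤1⇒m≡0∨1 (s≤s z≤n) = inj₂ refl

mult-1 : ∀ {q} m → AllPairs _>_ q → mult 1 (q ++ replicate m 1) ≡ m ⊎ mult 1 (q ++ replicate m 1) ≡ m + 1
mult-1 {q} m d with mult-++ 1 q (replicate m 1) | m≤1⇒m≡0∨1 (mult-strict 1 d)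
... | e | inj₁ e₀ = inj₁ (trans e (cong₂ _+_ e₀ (mult-replicate 1 m)))
... | e | inj₂ e₁ = inj₂ (trans e (trans (cong₂ _+_ e₁ (mult-replicate 1 m)) (+-comm 1 m)))

IsC3⇒IsPartition : ∀ {j n p} → IsC3 j n p → IsPartition n p
IsC3⇒IsPartition {j} (q , d , isPart , refl , s) = record
  { positive = All.++⁺ (All.map proj₁ isPart) (All.replicate⁺ (j * j) ≤-refl)
  ; nonIncr  = Linked.AllPairs⇒Linked (AllPairs.++⁺ (AllPairs.map <⇒≤ d) (replicate-AllPairs (j * j))
      (All.map (λ (1≤x , _) → All.replicate⁺ (j * j) 1≤x) isPart))
  ; sumEq    = trans (sum-++ q (replicate (j * j) 1)) (trans (cong (sum q +_) (sum-replicate-1 (j * j)))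
      (trans (+-comm (sum q) (j * j)) s))
  }
  where
  replicate-AllPairs : ∀ m → AllPairs _≥_ (replicate m 1)
  replicate-AllPairs zero    = []
  replicate-AllPairs (suc m) = All.replicate⁺ m ≤-refl ∷ replicate-AllPairs m

IsC3⇒C3Cond : ∀ {j n p} → IsC3 j n p → 1 ≤ j → C3Cond j p
IsC3⇒C3Cond {j} (q , d , isPart , refl , s) 1≤j = record
  { jPos         = 1≤j
  ; ones         = mult-1 (j * j) d
  ; oddDistinct  = λ k _ 1<k → distinct k (<⇒≢ 1<k)
  ; evenDistinct = λ k even → distinct k λ { refl → 2∤1 even }
  ; largeEven    = λ k k∈ even 2j<k → large even 2j<k (∈⇒allowed even k∈)
  ; gap          = λ i 1+j≤i i≤1+2j 2i∈ → not-in-gap 1+j≤i i≤1+2j (∈⇒allowed (m∣m*n i) 2i∈)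
  }
  where
  distinct : ∀ k → 1 ≢ k → mult k (q ++ replicate (j * j) 1) ≤ 1
  distinct k 1≢k = begin
    mult k (q ++ replicate (j * j) 1)        ≡⟨ mult-++ k q _ ⟩
    mult k q + mult k (replicate (j * j) 1)  ≡⟨ cong (mult k q +_) (≢⇒mult≡0 (All.replicate⁺ (j * j) 1≢k)) ⟩
    mult k q + 0                             ≡⟨ +-identityʳ _ ⟩
    mult k q                                 ≤⟨ mult-strict k d ⟩
    1                                        ∎
    where open ≤-Reasoning
  ∈⇒allowed : ∀ {k} → 2 ∣ k → k ∈ q ++ replicate (j * j) 1 → Allowed j k
  ∈⇒allowed even k∈ with ∈-++⁻ q k∈
  ... | inj₁ k∈q = proj₂ (All.lookup isPart k∈q)
  ... | inj₂ k∈1 with refl ← ∈-replicate (j * j) k∈1 = contradiction even 2∤1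
  large : ∀ {k} → 2 ∣ k → 2 * j < k → Allowed j k → (4 * j + 4 ≤ k) × (4 ∣ k)
  large even 2j<k (inj₁ odd)         = contradiction even odd
  large even 2j<k (inj₂ (inj₁ k≤2j)) = contradiction k≤2j (<⇒≱ 2j<k)
  large even 2j<k (inj₂ (inj₂ r))    = r
  not-in-gap : ∀ {i} → j + 1 ≤ i → i ≤ 2 * j + 1 → ¬ Allowed j (2 * i)
  not-in-gap {i} j<i _ (inj₁ odd)       = odd (m∣m*n i)
  not-in-gap j<i _ (inj₂ (inj₁ 2i≤2j))  =
    1+n≰n (≤-trans (≤-reflexive (+-comm 1 j)) (≤-trans j<i (*-cancelˡ-≤ 2 2i≤2j)))
  not-in-gap {i} _ i≤ (inj₂ (inj₂ (le , _))) = 1+n≰n (≤-trans (*-cancelˡ-≤ 2 (≤-trans (≤-reflexive (eq j)) le)) i≤)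
    where
    eq : ∀ j → 2 * suc (2 * j + 1) ≡ 4 * j + 4
    eq = solve-∀

-- Enumerating the partitions counted by c₃

c3-fixed : ℕ → ℕ → ℕ → List (List ℕ)
c3-fixed K j n = shift [] (j * j) (λ r → map (_++ replicate (j * j) 1) (strict j K r)) n

∈-c3-fixed⁻ : ∀ K j n {p} → p ∈ c3-fixed K j n → IsC3 j n p
∈-c3-fixed⁻ K j n p∈ with r , e , p∈′ ← ∈-shift⁻ (j * j) n p∈
                   with q , q∈ , refl ← ∈-map⁻ _ p∈′
                   with d , isPart , _ , refl ← strict-sound j K r q∈ = q , d , isPart , refl , e

∈-c3-fixed⁺ : ∀ {K} j n {p} → n ≤ K → IsC3 j n p → p ∈ c3-fixed K j n
∈-c3-fixed⁺ {K} j n n≤K (q , d , isPart , refl , refl) = ∈-shift⁺ (j * j) (sum q) (∈-map⁺ _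
  (strict-complete j K (sum q) (d , isPart ,
    All.map (λ x≤ → ≤-trans x≤ (≤-trans (m≤n+m (sum q) (j * j)) n≤K)) (parts≤sum q) , refl)))

c3-upTo : ℕ → ℕ → ℕ → List (List ℕ)
c3-upTo K zero    n = []
c3-upTo K (suc J) n = c3-upTo K J n ++ c3-fixed K (suc J) n

∈-c3-upTo⁻ : ∀ K J n {p} → p ∈ c3-upTo K J n → ∃ λ j → 1 ≤ j × j ≤ J × IsC3 j n p
∈-c3-upTo⁻ K (suc J) n p∈ with ∈-++⁻ (c3-upTo K J n) p∈
... | inj₁ p∈ˡ with j , 1≤j , j≤J , c ← ∈-c3-upTo⁻ K J n p∈ˡ = j , 1≤j , m≤n⇒m≤1+n j≤J , c
... | inj₂ p∈ʳ = suc J , s≤s z≤n , ≤-refl , ∈-c3-fixed⁻ K (suc J) n p∈ʳ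

∈-c3-upTo⁺ : ∀ {K j} J n {p} → n ≤ K → 1 ≤ j → j ≤ J → IsC3 j n p → p ∈ c3-upTo K J n
∈-c3-upTo⁺ {K} {suc j} (suc J) n n≤K 1≤j 1+j≤1+J c with suc j ≟ suc J
... | yes refl = ∈-++⁺ʳ (c3-upTo K J n) (∈-c3-fixed⁺ (suc J) n n≤K c)
... | no j≢J   = ∈-++⁺ˡ (∈-c3-upTo⁺ J n n≤K 1≤j (≤-pred (≤∧≢⇒< 1+j≤1+J j≢J)) c)

-- Keeps the multiplicities j² and j² + 1 of different j apart, so that no partition is listed
-- twice. The bound on i is essential: 0² + 1 = 1².
square+1<square : ∀ {i j} → 1 ≤ i → i < j → i * i + 1 < j * j
square+1<square {i} {j} 1≤i i<j = ≤-trans (begin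
  suc (i * i + 1)   ≤⟨ +-monoʳ-≤ (suc (i * i)) 1≤i ⟩
  suc (i * i) + i   ≤⟨ m≤m+n _ i ⟩
  suc (i * i) + i + i ≡⟨ eq i ⟩
  suc i * suc i     ∎) (*-mono-≤ i<j i<j)
  where
  open ≤-Reasoning
  eq : ∀ i → suc (i * i) + i + i ≡ suc i * suc i
  eq = solve-∀

IsC3-mult : ∀ {j n p} → IsC3 j n p → j * j ≤ mult 1 p × mult 1 p ≤ j * j + 1
IsC3-mult {j} (q , d , _ , refl , _) with mult-1 (j * j) d
... | inj₁ e = ≤-reflexive (sym e) , ≤-trans (≤-reflexive e) (m≤m+n _ 1)
... | inj₂ e = ≤-trans (m≤m+n _ 1) (≤-reflexive (sym e)) , ≤-reflexive e

c3-upTo-unique : ∀ K J n → Unique (c3-upTo K J n)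
c3-upTo-unique K zero    n = []
c3-upTo-unique K (suc J) n = Unique.++⁺ (c3-upTo-unique K J n)
  (shift-unique (suc J * suc J) n λ r → Unique.map⁺ (++-cancelʳ _ _ _) (strict-unique (suc J) K r))
  λ (p∈ˡ , p∈ʳ) → disjoint (∈-c3-upTo⁻ K J n p∈ˡ) (∈-c3-fixed⁻ K (suc J) n p∈ʳ)
  where
  disjoint : ∀ {p} → (∃ λ j → 1 ≤ j × j ≤ J × IsC3 j n p) → ¬ IsC3 (suc J) n p
  disjoint (j , 1≤j , j≤J , c) c′ = <⇒≱ (square+1<square 1≤j (s≤s j≤J))
    (≤-trans (proj₁ (IsC3-mult {suc J} c′)) (proj₂ (IsC3-mult {j} c)))

c3-upTo-parity : ∀ K J n → parity (length (c3-upTo K J n)) ≡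
  ∑ J (λ j → X^ (suc j * suc j) · parts (suc j) K ⊙ 1s) n
c3-upTo-parity K zero    n = refl
c3-upTo-parity K (suc J) n = begin
  parity (length (c3-upTo K J n ++ c3-fixed K (suc J) n))
    ≡⟨ trans (cong parity (length-++ (c3-upTo K J n))) (ℙ.+-homo-+ (length (c3-upTo K J n)) _) ⟩
  parity (length (c3-upTo K J n)) +ₚ parity (length (c3-fixed K (suc J) n))
    ≡⟨ cong₂ _+ₚ_ (c3-upTo-parity K J n) (trans
         (shift-parity (suc J * suc J) n λ r →
           trans (cong parity (length-map _ (strict (suc J) K r))) (strict-parity (suc J) K r))
         (sym (X-coeff (suc J * suc J) _ n))) ⟩
  ∑ J t n +ₚ t J n
    ≡⟨ ⊕-coeff (∑ J t) (t J) n ⟨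
  ∑ (suc J) t n ∎
  where
  open ≡-Reasoning
  t : ℕ → Series
  t j = X^ (suc j * suc j) · parts (suc j) K ⊙ 1s

c3-count : ∀ n → HasCount (C3Partition n) (length (c3-upTo (suc n * 4) (suc n) n))
c3-count n = c3-upTo (suc n * 4) (suc n) n , c3-upTo-unique _ (suc n) n ,
  (λ p → mk⇔
    (λ p∈ → let j , 1≤j , _ , c = ∈-c3-upTo⁻ (suc n * 4) (suc n) n p∈ in
      IsC3⇒IsPartition {j} c , j , IsC3⇒C3Cond c 1≤j)
    λ (isPartition , j , cond) → let c = C3Cond⇒IsC3 isPartition cond in
      ∈-c3-upTo⁺ (suc n) n (≤-trans (n≤1+n n) (m≤m*n (suc n) 4)) (C3Cond.jPos cond)
        (j≤1+n (C3Cond.jPos cond) c) c) ,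
  refl
  where
  j≤1+n : ∀ {j p} → 1 ≤ j → IsC3 j n p → j ≤ suc n
  j≤1+n {suc j} _ (q , _ , _ , _ , refl) =
    ≤-trans (m≤m*n (suc j) (suc j)) (≤-trans (m≤m+n (suc j * suc j) (sum q)) (n≤1+n _))

-- From the count to the coefficient of the series

c3-parity : ∀ n → parity (length (c3-upTo (suc n * 4) (suc n) n)) ≡ c3-series (suc n) n
c3-parity n = trans (c3-upTo-parity (suc n * 4) (suc n) n)
  (coeff (∑-cong (suc n) λ j j<L → X-cong (suc j * suc j) (parts-c3-term (suc n) j<L)) n ≤-refl)
  where open Truncated (suc n)

c3-even : ∀ {r} → r < 11 → QuadMisses r 6 2 → QuadMisses r 6 4 → QuadMisses r 4 1 → QuadMisses r 4 3 →
  ∀ n → C3Even (11 * n + r)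
c3-even {r} r<11 m₂ m₄ m₁ m₃ n = _ , c3-count (11 * n + r) , even⇒2∣ _ (trans (c3-parity (11 * n + r))
  (c3-series-vanish ≤-refl (quad-≢ n r<11 m₂) (quad-≢ n r<11 m₄) (quad-≢ n r<11 m₁) (quad-≢ n r<11 m₃)))

theorem4 : ∀ (n : ℕ) → C3Even (11 * n + 5) × C3Even (11 * n + 7) × C3Even (11 * n + 9)
theorem4 n =
  c3-even (m≤m+n 6 5) (from-yes (quadMisses? 5 6 2)) (from-yes (quadMisses? 5 6 4))
    (from-yes (quadMisses? 5 4 1)) (from-yes (quadMisses? 5 4 3)) n ,
  c3-even (m≤m+n 8 3) (from-yes (quadMisses? 7 6 2)) (from-yes (quadMisses? 7 6 4))
    (from-yes (quadMisses? 7 4 1)) (from-yes (quadMisses? 7 4 3)) n ,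
  c3-even (m≤m+n 10 1) (from-yes (quadMisses? 9 6 2)) (from-yes (quadMisses? 9 6 4))
    (from-yes (quadMisses? 9 4 1)) (from-yes (quadMisses? 9 4 3)) n
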